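{- The proof system $\mathcal{H}^{ - }_{\mathsf{DPL}}$ is decidable: there is an algorithm which, given a formula $\varphi$ of $\mathcal{L}_{\mathsf{DPL}}$, decides whether $\varphi$ is a theorem of $\mathcal{H}^{ - }_{\mathsf{DPL}}$.
   Context: Let $\mathbb{P}$ be a countable set of propositional variables. The formulas of $\mathcal{L}_{\mathsf{DPL}}$ are given by $\varphi ::= p \mid \neg\varphi \mid \varphi\wedge\varphi \mid L_r\varphi \mid \bigcirc\varphi$ with $p\in\mathbb{P}$, $r\in\mathbb{Q}\cap[0,1]$; $\bigcirc^n$ is $n$-fold iteration of $\bigcirc$. The Hilbert system $\mathcal{H}^{ - }_{\mathsf{DPL}}$ has the axiom schemes: propositional tautologies; $L_0\bot$; $L_r\neg\varphi\to\neg L_s\varphi$ if $r+s>1$; $L_r(\varphi\wedge\psi)\wedge L_s(\varphi\wedge\neg\psi)\to L_{r+s}\varphi$ if $r+s\le 1$; $\neg L_r(\varphi\wedge\psi)\wedge\neg L_s(\varphi\wedge\neg\psi)\to\neg L_{r+s}\varphi$ if $r+s\le1$; $L_1(\varphi\to\psi)\to(L_r\varphi\to L_r\psi)$; $\bigcirc\neg\varphi\leftrightarrow\neg\bigcirc\varphi$; $\bigcirc(\varphi\wedge\psi)\leftrightarrow(\bigcirc\varphi\wedge\bigcirc\psi)$; and rules: modus ponens; from $\{\psi\to\bigcirc^nL_s\varphi \mid s<r,\ s\in\mathbb{Q}\cap[0,1]\}$ infer $\psi\to\bigcirc^nL_r\varphi$ (each $n\in\mathbb{N}$); from $\varphi$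 infer $L_1\varphi$; from $\varphi$ infer $\bigcirc\varphi$. Theorems are last elements of (possibly transfinite, countable-length) derivations in which each element is an axiom or follows by a rule from earlier elements. (Equivalently, the theorems are exactly the formulas valid in all dynamic Markov processes $\langle\Omega,\mathcal{A},T,f\rangle$, with $T$ a Markov kernel and $f$ measurable, under the semantics $w\vDash L_r\varphi$ iff $T(w,[\![\varphi]\!])\ge r$ and $w\vDash\bigcirc\varphi$ iff $f(w)\vDash\varphi$.) -}

module Defs where

open import Data.Nat using (ℕ; zero; suc)
open import Data.Bool using (Bool; true; false; not; _∧_)
open import Data.Rational using (ℚ; 0ℚ; 1ℚ; _+_; _≤_; _<_)
open import Relation.Binary.PropositionalEquality using (_≡_)
open import Data.Rational.Properties using (≤-refl; nonNegative⁻¹)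

-- Rationals in [0,1] (bound proofs irrelevant, so equality is equality of values)
record Q01 : Set where
  constructor q01
  field
    val : ℚ
    .lo : 0ℚ ≤ val
    .hi : val ≤ 1ℚ
open Q01 public

zero01 : Q01
zero01 = q01 0ℚ (≤-refl {0ℚ}) (nonNegative⁻¹ 1ℚ)

one01 : Q01
one01 = q01 1ℚ (nonNegative⁻¹ 1ℚ) (≤-refl {1ℚ})

data Form : Set where
  var  : ℕ → Form
  ¬'_  : Form → Form
  _∧'_ : Form → Form → Form
  L    : Q01 → Form → Form
  ○    : Form → Form

infixr 6 _∧'_
infixr 5 _⇒_
infix 4 _⇔_

_⇒_ : Form → Form → Form
φ ⇒ ψ = ¬' (φ ∧' ¬' ψ)

_⇔_ : Form → Form → Form
φ ⇔ ψ = (φ ⇒ ψ) ∧' (ψ ⇒ φ)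

⊥' : Form
⊥' = var 0 ∧' ¬' var 0

○^ : ℕ → Form → Form
○^ zero    φ = φ
○^ (suc n) φ = ○ (○^ n φ)

-- Propositional tautologies (instances): true under every Boolean valuation
-- of the maximal non-Boolean subformulas (variables, L_r ψ, ○ψ).
eval : (Form → Bool) → Form → Bool
eval v (¬' φ)   = not (eval v φ)
eval v (φ ∧' ψ) = eval v φ ∧ eval v ψ
eval v φ        = v φ

Tautology : Form → Set
Tautology φ = (v : Form → Bool) → eval v φ ≡ true

-- Theorems of H⁻_DPL, inductively generated (well-founded, possibly
-- infinitely branching derivation trees = countable transfinite derivations).
data Thm : Form → Set where
  taut   : ∀ {φ} → Tautology φ → Thm φ
  ax-L0  : Thm (L zero01 ⊥')
  ax-neg : ∀ (r s : Q01) φ → 1ℚ < val r + val s →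
           Thm (L r (¬' φ) ⇒ ¬' L s φ)
  ax-add : ∀ (r s t : Q01) φ ψ → val r + val s ≡ val t →
           Thm ((L r (φ ∧' ψ) ∧' L s (φ ∧' ¬' ψ)) ⇒ L t φ)
  ax-sub : ∀ (r s t : Q01) φ ψ → val r + val s ≡ val t →
           Thm ((¬' L r (φ ∧' ψ) ∧' ¬' L s (φ ∧' ¬' ψ)) ⇒ ¬' L t φ)
  ax-K   : ∀ (r : Q01) φ ψ →
           Thm (L one01 (φ ⇒ ψ) ⇒ (L r φ ⇒ L r ψ))
  ax-○¬  : ∀ φ → Thm (○ (¬' φ) ⇔ ¬' ○ φ)
  ax-○∧  : ∀ φ ψ → Thm (○ (φ ∧' ψ) ⇔ (○ φ ∧' ○ ψ))
  mp     : ∀ {φ ψ} → Thm (φ ⇒ ψ) → Thm φ → Thm ψ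
  arch   : ∀ (n : ℕ) (r : Q01) φ ψ →
           ((s : Q01) → val s < val r → Thm (ψ ⇒ ○^ n (L s φ))) →
           Thm (ψ ⇒ ○^ n (L r φ))
  nec-L  : ∀ {φ} → Thm φ → Thm (L one01 φ)
  nec-○  : ∀ {φ} → Thm φ → Thm (○ φ)

{-# OPTIONS --safe #-}
module Submission where

-- A formula of modal depth n is a Boolean combination of variables, formulas ○θ and
-- formulas L r ψ with θ, ψ of smaller depth, so it suffices to decide whether a
-- conjunction of literals of these three kinds is refutable or holds at the root of a
-- finite tree with rational transition probabilities.  The variables are trivial and the
-- ○-literals reduce to smaller depth because ○ commutes with the connectives.
-- For the L-literals, the unknowns are the probabilities x σ of the cells ±ψ₁ ∧ … ∧ ±ψₖ,
-- with x σ = 0 if the cell is refutable; they satisfy a system of linear inequalities,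
-- ¬ L s ψ being read as "at most s - η".  Fourier–Motzkin elimination either
-- solves it for some η > 0, which gives a tree, or shows that for arbitrarily small η
-- there is a δ > 0 for which even the system with slack proportional to δ is infeasible.
-- In the latter case the rule arch replaces ¬ L s ψ by ¬ L (s - η) ψ, each x σ is
-- located up to δ by propositional case distinctions, and by ax-add and ax-sub each such
-- case contradicts one of the inequalities.

open import Defs
open import Data.Bool using (Bool; true; false; not; _∧_; if_then_else_)
open import Data.Bool.Properties using (∧-conicalˡ; ∧-conicalʳ; ∧-inverseʳ; ¬-not)
  renaming (_≟_ to _≟ᵇ_)
open import Data.Fin using (Fin; zero; suc)
import Data.Fin.Properties as Fin
open import Data.Integer as ℤ using (-[1+_])
import Data.Integer.Properties as ℤ
open import Data.List as List using (List; []; _∷_; _++_; map)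
open import Data.List.Relation.Unary.All as All using (All; []; _∷_)
import Data.List.Relation.Unary.All.Properties as All
open import Data.Nat as ℕ using (ℕ; zero; suc)
import Data.Nat.Properties as ℕ
open import Data.Product using (∃-syntax; _×_; _,_; proj₁; proj₂)
open import Data.Rational
open import Data.Rational.Properties
open import Data.Rational.Solver using (module +-*-Solver)
open import Data.Rational.Unnormalised as ℚᵘ using (mkℚᵘ; *≡*)
import Data.Rational.Unnormalised.Properties as ℚᵘ
open import Data.Sum using (_⊎_; inj₁; inj₂; [_,_]′)
open import Data.Unit using (⊤; tt)
open import Data.Vec as Vec using (Vec; []; _∷_; lookup; fromList)
open import Data.Vec.Properties using (lookup-map)
open import Function using (_∘_; const; id)
open import Relation.Binary.Definitions using (tri<; tri≈; tri>)
open import Relation.Binary.PropositionalEquality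
open import Relation.Nullary using (Dec; yes; no; does; ¬_; contradiction)
open import Relation.Nullary.Decidable using (dec-true; dec-false; recompute)
open +-*-Solver using (solve; _:=_; _:+_; _:*_; _:-_; :-_; con)

-- Ordered field lemmas and Fourier–Motzkin elimination

≤⇒0≤- : ∀ {p q} → p ≤ q → 0ℚ ≤ q - p
≤⇒0≤- {p} {q} p≤q = subst (_≤ q - p) (+-inverseʳ p) (+-monoˡ-≤ (- p) p≤q)

0≤-⇒≤ : ∀ {p q} → 0ℚ ≤ q - p → p ≤ q
0≤-⇒≤ {p} {q} h = subst₂ _≤_ (+-identityˡ p)
  (solve 2 (λ p q → (q :- p) :+ p := q) refl p q) (+-monoˡ-≤ p h)

<⇒0<- : ∀ {p q} → p < q → 0ℚ < q - p
<⇒0<- {p} {q} p<q = subst (_< q - p) (+-inverseʳ p) (+-monoˡ-< (- p) p<q)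

0<-⇒< : ∀ {p q} → 0ℚ < q - p → p < q
0<-⇒< {p} {q} h = subst₂ _<_ (+-identityˡ p)
  (solve 2 (λ p q → (q :- p) :+ p := q) refl p q) (+-monoˡ-< p h)

≤-from-gap : ∀ {p q c} → 0ℚ ≤ c → q - p ≡ c → p ≤ q
≤-from-gap h eq = 0≤-⇒≤ (subst (0ℚ ≤_) (sym eq) h)

<-from-gap : ∀ {p q c} → 0ℚ < c → q - p ≡ c → p < q
<-from-gap h eq = 0<-⇒< (subst (0ℚ <_) (sym eq) h)

0≤+ : ∀ {p q} → 0ℚ ≤ p → 0ℚ ≤ q → 0ℚ ≤ p + q
0≤+ = +-mono-≤

0≤* : ∀ {p q} → 0ℚ ≤ p → 0ℚ ≤ q → 0ℚ ≤ p * q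
0≤* {p} {q} hp hq = nonNegative⁻¹ _
  {{nonNeg*nonNeg⇒nonNeg p {{nonNegative hp}} q {{nonNegative hq}}}}

0<* : ∀ {p q} → 0ℚ < p → 0ℚ < q → 0ℚ < p * q
0<* {p} {q} hp hq = positive⁻¹ _ {{pos*pos⇒pos p {{positive hp}} q {{positive hq}}}}

inverse : ∀ {p} → 0ℚ < p → ∃[ q ] 0ℚ < q × p * q ≡ 1ℚ
inverse {p} h = (1/ p) , positive⁻¹ _ {{1/pos⇒pos p}} , *-inverseʳ p
  where
  instance
    p-pos : Positive p
    p-pos = positive h
    p-nz : NonZero p
    p-nz = pos⇒nonZero p

*-cancel-inverse : ∀ p q r → p * q ≡ 1ℚ → p * (q * r) ≡ r
*-cancel-inverse p q r pq≡1 =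
  trans (sym (*-assoc p q r)) (trans (cong (_* r) pq≡1) (*-identityˡ r))

0<-⊓ : ∀ {p q} → 0ℚ < p → 0ℚ < q → 0ℚ < p ⊓ q
0<-⊓ {p} {q} hp hq with ≤-total p q
... | inj₁ p≤q = subst (0ℚ <_) (sym (p≤q⇒p⊓q≡p p≤q)) hp
... | inj₂ q≤p = subst (0ℚ <_) (sym (p≥q⇒p⊓q≡q q≤p)) hq

-- For e ≤ 0 any threshold works. Otherwise t is h / e for some h strictly between 0 and g, so that
-- e η ≤ h < g.
*-below : ∀ e {g} → 0ℚ < g → ∃[ t ] 0ℚ < t × (∀ {η} → 0ℚ ≤ η → η ≤ t → e * η < g)
*-below e {g} g>0 with e ≤? 0ℚ
... | yes e≤0 = 1ℚ , positive⁻¹ 1ℚ , λ {η} η≥0 _ →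
  ≤-<-trans (≤-from-gap (0≤* (≤⇒0≤- e≤0) η≥0)
    (solve 2 (λ e η → con 0ℚ :- e :* η := (con 0ℚ :- e) :* η) refl e η)) g>0
... | no e≰0 with <-dense g>0 | inverse (≰⇒> e≰0)
... | h , h>0 , h<g | i , i>0 , ei≡1 = h * i , 0<* h>0 i>0 , λ {η} η≥0 η≤t →
  ≤-<-trans (≤-from-gap (0≤* (<⇒≤ (≰⇒> e≰0)) (≤⇒0≤- η≤t))
    (trans (cong (_- e * η) (trans (sym (*-identityʳ h)) (cong (h *_) (sym ei≡1))))
      (solve 4 (λ e η h i → h :* (e :* i) :- e :* η := e :* (h :* i :- η)) refl e η h i))) h<g

-- Affine forms together with the points at which they are evaluated. Elimination only adds and
-- scales forms, so compatibility of these two operations with evaluation is all that is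
-- axiomatised.
record Space : Set₁ where
  infix 8 _∙_
  field
    Coef Pt : Set
    _∙_     : Coef → Pt → ℚ
    _⊕_     : Coef → Coef → Coef
    _⊙_     : ℚ → Coef → Coef
    ⊕-∙     : ∀ u v p → (u ⊕ v) ∙ p ≡ u ∙ p + v ∙ p
    ⊙-∙     : ∀ a u p → (a ⊙ u) ∙ p ≡ a * (u ∙ p)

  Holds : Pt → Coef → Set
  Holds p u = 0ℚ ≤ u ∙ p

open Space using (Coef; Pt; Holds)

line : Space → Space
line S = record
  { Coef = ℚ × S.Coef
  ; Pt   = ℚ × S.Pt
  ; _∙_  = λ (a , u) (x , p) → a * x + u S.∙ p
  ; _⊕_  = λ (a , u) (b , v) → a + b , u S.⊕ v
  ; _⊙_  = λ c (a , u) → c * a , c S.⊙ u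
  ; ⊕-∙  = λ (a , u) (b , v) (x , p) → trans (cong ((a + b) * x +_) (S.⊕-∙ u v p))
      (solve 5 (λ a b x y z → (a :+ b) :* x :+ (y :+ z) := (a :* x :+ y) :+ (b :* x :+ z))
        refl a b x (u S.∙ p) (v S.∙ p))
  ; ⊙-∙  = λ c (a , u) (x , p) → trans (cong (c * a * x +_) (S.⊙-∙ c u p))
      (solve 4 (λ c a x y → c :* a :* x :+ c :* y := c :* (a :* x :+ y)) refl c a x (u S.∙ p))
  }
  where module S = Space S

-- Adjoins 2^k unknowns, one for each sign vector of length k: the outer copy of `cube k` carries
-- the vectors that begin with `true`, the inner copy those that begin with `false`.
cube : ℕ → Space → Space
cube zero    S = line S
cube (suc k) S = cube k (cube k S)

module _ (S : Space) where
  open Space S using (_∙_; _⊕_; _⊙_; ⊕-∙; ⊙-∙)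

  -- Normal form of a x + u ≥ 0 after division by the absolute value of a: `lower u` is x ≥ - u,
  -- `upper u` is x ≤ u, and `free u` is the case a = 0.
  data Bound : Set where
    lower free upper : Coef S → Bound

  BoundHolds : ℚ → Pt S → Bound → Set
  BoundHolds x p (lower u) = 0ℚ ≤ x + u ∙ p
  BoundHolds x p (free u)  = 0ℚ ≤ u ∙ p
  BoundHolds x p (upper u) = 0ℚ ≤ u ∙ p - x

  bound : (r : Coef (line S)) → ∃[ b ] ∀ x p →
          (Holds (line S) (x , p) r → BoundHolds x p b) × (BoundHolds x p b → Holds (line S) (x , p) r)
  bound (a , u) with <-cmp a 0ℚ
  ... | tri≈ _ a≡0 _ = free u , λ x p →
        subst (0ℚ ≤_) (eq x p) , subst (0ℚ ≤_) (sym (eq x p))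
    where
    eq : ∀ x p → a * x + u ∙ p ≡ u ∙ p
    eq x p = trans (cong (λ a → a * x + u ∙ p) a≡0)
      (solve 2 (λ x y → con 0ℚ :* x :+ y := y) refl x (u ∙ p))
  ... | tri> _ _ a>0 = let i , i>0 , ai≡1 = inverse a>0 in
        lower (i ⊙ u) , λ x p →
          let eq₁ : i * (a * x + u ∙ p) ≡ x + (i ⊙ u) ∙ p
              eq₁ = trans (solve 4 (λ i a x y → i :* (a :* x :+ y) := (a :* i) :* x :+ i :* y)
                            refl i a x (u ∙ p))
                    (cong₂ _+_ (trans (cong (_* x) ai≡1) (*-identityˡ x)) (sym (⊙-∙ i u p)))
              eq₂ : a * (x + (i ⊙ u) ∙ p) ≡ a * x + u ∙ p
              eq₂ = trans (cong (a *_) (sym eq₁))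
                    (*-cancel-inverse a i (a * x + u ∙ p) ai≡1)
          in (λ h → subst (0ℚ ≤_) eq₁ (0≤* (<⇒≤ i>0) h)) ,
             (λ h → subst (0ℚ ≤_) eq₂ (0≤* (<⇒≤ a>0) h))
  ... | tri< a<0 _ _ = let i , i>0 , ai≡1 = inverse (neg-antimono-< a<0) in
        upper (i ⊙ u) , λ x p →
          let eq₁ : i * (a * x + u ∙ p) ≡ (i ⊙ u) ∙ p - x
              eq₁ = trans (solve 4 (λ i a x y → i :* (a :* x :+ y) := i :* y :- ((:- a) :* i) :* x)
                            refl i a x (u ∙ p))
                    (cong₂ _-_ (sym (⊙-∙ i u p)) (trans (cong (_* x) ai≡1) (*-identityˡ x)))
              eq₂ : (- a) * ((i ⊙ u) ∙ p - x) ≡ a * x + u ∙ p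
              eq₂ = trans (cong ((- a) *_) (sym eq₁))
                    (*-cancel-inverse (- a) i (a * x + u ∙ p) ai≡1)
          in (λ h → subst (0ℚ ≤_) eq₁ (0≤* (<⇒≤ i>0) h)) ,
             (λ h → subst (0ℚ ≤_) eq₂ (0≤* (<⇒≤ (neg-antimono-< a<0)) h))

  lowers frees uppers : List Bound → List (Coef S)
  lowers []             = []
  lowers (lower u ∷ bs) = u ∷ lowers bs
  lowers (free u  ∷ bs) = lowers bs
  lowers (upper u ∷ bs) = lowers bs
  frees []             = []
  frees (lower u ∷ bs) = frees bs
  frees (free u  ∷ bs) = u ∷ frees bs
  frees (upper u ∷ bs) = frees bs
  uppers []             = []
  uppers (lower u ∷ bs) = uppers bs
  uppers (free u  ∷ bs) = uppers bs
  uppers (upper u ∷ bs) = u ∷ uppers bs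

  BoundsHold : ℚ → Pt S → List Bound → Set
  BoundsHold x p bs = All (λ u → 0ℚ ≤ x + u ∙ p) (lowers bs)
                    × All (Holds S p) (frees bs)
                    × All (λ u → 0ℚ ≤ u ∙ p - x) (uppers bs)

  split : ∀ {x p} bs → All (BoundHolds x p) bs → BoundsHold x p bs
  split []             []       = [] , [] , []
  split (lower u ∷ bs) (h ∷ hs) = let ls , fs , us = split bs hs in h ∷ ls , fs , us
  split (free u  ∷ bs) (h ∷ hs) = let ls , fs , us = split bs hs in ls , h ∷ fs , us
  split (upper u ∷ bs) (h ∷ hs) = let ls , fs , us = split bs hs in ls , fs , h ∷ us

  unsplit : ∀ {x p} bs → BoundsHold x p bs → All (BoundHolds x p) bs
  unsplit []             _                = []
  unsplit (lower u ∷ bs) (h ∷ ls , fs , us) = h ∷ unsplit bs (ls , fs , us)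
  unsplit (free u  ∷ bs) (ls , h ∷ fs , us) = h ∷ unsplit bs (ls , fs , us)
  unsplit (upper u ∷ bs) (ls , fs , h ∷ us) = h ∷ unsplit bs (ls , fs , us)

  -- The Fourier-Motzkin combinations: - l ≤ x and x ≤ u are compatible exactly if l + u is
  -- nonnegative.
  sums : List (Coef S) → List (Coef S) → List (Coef S)
  sums []       us = []
  sums (l ∷ ls) us = map (l ⊕_) us ++ sums ls us

  sums-hold : ∀ {x p} ls us → All (λ u → 0ℚ ≤ x + u ∙ p) ls → All (λ u → 0ℚ ≤ u ∙ p - x) us →
              All (Holds S p) (sums ls us)
  sums-hold []       us []       hus = []
  sums-hold {x} {p} (l ∷ ls) us (h ∷ hs) hus = All.++⁺
    (All.map⁺ (All.map (λ {u} hu → subst (0ℚ ≤_)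
      (trans (solve 3 (λ x y z → (x :+ y) :+ (z :- x) := y :+ z) refl x (l ∙ p) (u ∙ p))
        (sym (⊕-∙ l u p))) (0≤+ h hu)) hus))
    (sums-hold ls us hs hus)

  -- The witness is the maximum of 0 and all lower bounds `- (l ∙ p)`, built up along `ls`.
  -- Nonnegative upper bounds make the starting value 0 admissible.
  between : ∀ {p} ls us → All (Holds S p) us → All (Holds S p) (sums ls us) →
            ∃[ x ] 0ℚ ≤ x × All (λ u → 0ℚ ≤ x + u ∙ p) ls × All (λ u → 0ℚ ≤ u ∙ p - x) us
  between {p} [] us hus _ = 0ℚ , ≤-refl , [] ,
    All.map (λ {u} → subst (0ℚ ≤_) (solve 1 (λ y → y := y :- con 0ℚ) refl (u ∙ p))) hus
  between {p} (l ∷ ls) us hus hs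
    with between ls us hus (All.++⁻ʳ (map (l ⊕_) us) hs)
       | All.map⁻ (All.++⁻ˡ (map (l ⊕_) us) hs)
  ... | x , x≥0 , hls , hxs | hl with ≤-total x (- (l ∙ p))
  ... | inj₁ x≤l = - (l ∙ p) , ≤-trans x≥0 x≤l ,
        (≤-reflexive (sym (+-inverseˡ (l ∙ p)))) ∷ All.map (λ {u} h → ≤-trans h (+-monoˡ-≤ (u ∙ p) x≤l)) hls ,
        All.map (λ {u} h → subst (0ℚ ≤_) (trans (⊕-∙ l u p)
          (solve 2 (λ y z → y :+ z := z :- (:- y)) refl (l ∙ p) (u ∙ p))) h) hl
  ... | inj₂ l≤x = x , x≥0 ,
        flip-sign (≤⇒0≤- l≤x) ∷ hls , hxs
    where
    flip-sign : 0ℚ ≤ x - - (l ∙ p) → 0ℚ ≤ x + l ∙ p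
    flip-sign = subst (0ℚ ≤_) (solve 2 (λ x y → x :- (:- y) := x :+ y) refl x (l ∙ p))

  -- Eliminates a variable x ≥ 0, which is required to be 0 if the flag is false.
  project : Bool → List (Coef (line S)) → List (Coef S)
  project false rs = map proj₂ rs
  project true  rs = let bs = map (proj₁ ∘ bound) rs in
                     frees bs ++ uppers bs ++ sums (lowers bs) (uppers bs)

  0*+ : ∀ a y → a * 0ℚ + y ≡ y
  0*+ = solve 2 (λ a y → a :* con 0ℚ :+ y := y) refl

  project-sound : ∀ b rs {x p} → 0ℚ ≤ x → (b ≡ false → x ≡ 0ℚ) →
                  All (Holds (line S) (x , p)) rs → All (Holds S p) (project b rs)
  project-sound false rs {x} {p} _ x≡0 hs = All.map⁺ (All.map
    (λ {(a , u)} → subst (0ℚ ≤_) (trans (cong (λ x → a * x + u ∙ p) (x≡0 refl)) (0*+ a (u ∙ p)))) hs)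
  project-sound true  rs {x} {p} x≥0 _ hs
    with split (map (proj₁ ∘ bound) rs)
           (All.map⁺ (All.map (λ {r} → proj₁ (proj₂ (bound r) x p)) hs))
  ... | ls , fs , us = All.++⁺ fs (All.++⁺
        (All.map (λ {u} h → subst (0ℚ ≤_)
          (solve 2 (λ x y → (y :- x) :+ x := y) refl x (u ∙ p)) (0≤+ h x≥0)) us)
        (sums-hold _ _ ls us))

  project-complete : ∀ b rs {p} → All (Holds S p) (project b rs) →
                     ∃[ x ] 0ℚ ≤ x × (b ≡ false → x ≡ 0ℚ) × All (Holds (line S) (x , p)) rs
  project-complete false rs {p} hs = 0ℚ , ≤-refl , (λ _ → refl) , All.map
    (λ {(a , u)} → subst (0ℚ ≤_) (sym (0*+ a (u ∙ p)))) (All.map⁻ hs)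
  project-complete true  rs {p} hs
    with between (lowers bs) (uppers bs) (All.++⁻ˡ _ (All.++⁻ʳ (frees bs) hs))
           (All.++⁻ʳ (uppers bs) (All.++⁻ʳ (frees bs) hs))
    where bs = map (proj₁ ∘ bound) rs
  ... | x , x≥0 , ls , us = x , x≥0 , (λ ()) ,
        All.map (λ {r} → proj₂ (proj₂ (bound r) x p))
          (All.map⁻ (unsplit bs (ls , All.++⁻ˡ (frees bs) hs , us)))
    where bs = map (proj₁ ∘ bound) rs

-- Elimination of unknowns indexed by sign vectors

base : ∀ k {S} → Pt (cube k S) → Pt S
base zero    (x , p) = p
base (suc k) P       = base k (base k P)

coord : ∀ k {S} → Pt (cube k S) → Vec Bool k → ℚ
coord zero    (x , p) []          = x
coord (suc k) P       (true  ∷ σ) = coord k P σ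
coord (suc k) P       (false ∷ σ) = coord k (base k P) σ

Supported : ∀ {k} → (Vec Bool k → Bool) → (Vec Bool k → ℚ) → Set
Supported ok x = ∀ σ → 0ℚ ≤ x σ × (ok σ ≡ false → x σ ≡ 0ℚ)

eliminate : ∀ k {S} → (Vec Bool k → Bool) → List (Coef (cube k S)) → List (Coef S)
eliminate zero    {S} ok rs = project S (ok []) rs
eliminate (suc k)     ok rs = eliminate k (ok ∘ (false ∷_)) (eliminate k (ok ∘ (true ∷_)) rs)

eliminate-sound : ∀ k {S} ok rs {P} → Supported ok (coord k {S} P) →
                  All (Holds (cube k S) P) rs → All (Holds S (base k P)) (eliminate k ok rs)
eliminate-sound zero    {S} ok rs supp hs = project-sound S (ok []) rs (proj₁ (supp [])) (proj₂ (supp [])) hs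
eliminate-sound (suc k) ok rs supp hs =
  eliminate-sound k (ok ∘ (false ∷_)) _ (supp ∘ (false ∷_))
    (eliminate-sound k (ok ∘ (true ∷_)) rs (supp ∘ (true ∷_)) hs)

eliminate-complete : ∀ k {S} ok rs {p} → All (Holds S p) (eliminate k ok rs) →
  ∃[ P ] base k {S} P ≡ p × Supported ok (coord k P) × All (Holds (cube k S) P) rs
eliminate-complete zero {S} ok rs {p} hs with project-complete S (ok []) rs hs
... | x , x≥0 , x≡0 , hrs = (x , p) , refl , (λ { [] → x≥0 , x≡0 }) , hrs
eliminate-complete (suc k) ok rs hs
  with eliminate-complete k (ok ∘ (false ∷_)) (eliminate k (ok ∘ (true ∷_)) rs) hs
... | P , refl , suppP , hP with eliminate-complete k (ok ∘ (true ∷_)) rs hP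
... | Q , refl , suppQ , hQ = Q , refl , (λ { (true ∷ σ) → suppQ σ ; (false ∷ σ) → suppP σ }) , hQ

Σ□ : ∀ {k} → (Vec Bool k → ℚ) → ℚ
Σ□ {zero}  f = f []
Σ□ {suc k} f = Σ□ (f ∘ (true ∷_)) + Σ□ (f ∘ (false ∷_))

functional : ∀ k {S} → (Vec Bool k → ℚ) → Coef S → Coef (cube k S)
functional zero    f c = f [] , c
functional (suc k) f c = functional k (f ∘ (true ∷_)) (functional k (f ∘ (false ∷_)) c)

functional-∙ : ∀ k {S} f c P → Space._∙_ (cube k S) (functional k {S} f c) P
               ≡ Σ□ (λ σ → f σ * coord k P σ) + Space._∙_ S c (base k P)
functional-∙ zero    f c P = refl
functional-∙ (suc k) {S} f c P = trans (functional-∙ k (f ∘ (true ∷_)) _ P)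
  (trans (cong (Σ□ (λ σ → f (true ∷ σ) * coord k P σ) +_) (functional-∙ k {S} (f ∘ (false ∷_)) c (base k P)))
    (sym (+-assoc (Σ□ (λ σ → f (true ∷ σ) * coord k P σ)) _ _)))

point : ∀ k {S} → (Vec Bool k → ℚ) → Pt S → Pt (cube k S)
point zero    x p = x [] , p
point (suc k) x p = point k (x ∘ (true ∷_)) (point k (x ∘ (false ∷_)) p)

base-point : ∀ k {S} x p → base k {S} (point k x p) ≡ p
base-point zero    x p = refl
base-point (suc k) x p = trans (cong (base k) (base-point k _ _)) (base-point k _ p)

coord-point : ∀ k {S} x p σ → coord k {S} (point k x p) σ ≡ x σ
coord-point zero    x p []          = refl
coord-point (suc k) x p (true  ∷ σ) = coord-point k _ _ σ
coord-point (suc k) x p (false ∷ σ) = trans (cong (λ P → coord k P σ) (base-point k _ _)) (coord-point k _ p σ)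

Σ□-cong : ∀ {k} {f g : Vec Bool k → ℚ} → (∀ σ → f σ ≡ g σ) → Σ□ f ≡ Σ□ g
Σ□-cong {zero}  h = h []
Σ□-cong {suc k} h = cong₂ _+_ (Σ□-cong (h ∘ (true ∷_))) (Σ□-cong (h ∘ (false ∷_)))

<⇒≱ : ∀ {p q} → p < q → ¬ q ≤ p
<⇒≱ p<q q≤p = <-irrefl refl (<-≤-trans p<q q≤p)


-- Linear conditions for small margins and accuracies

constants : Space
constants = record
  { Coef = ℚ ; Pt = ⊤ ; _∙_ = λ c _ → c ; _⊕_ = _+_ ; _⊙_ = _*_
  ; ⊕-∙ = λ _ _ _ → refl ; ⊙-∙ = λ _ _ _ → refl }

-- A coefficient (e , d , c) stands for e η + d δ + c, where η is the margin by which strict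
-- inequalities hold and δ is the accuracy of approximate solutions.
affine : Space
affine = line (line constants)

Positive-for-small : ℚ × ℚ × ℚ → Set
Positive-for-small u = ∃[ t ] 0ℚ < t × (∀ {η} → 0ℚ ≤ η → η ≤ t → Holds affine (η , 0ℚ , tt) u)

-- Only η has to go below every bound; δ is merely positive and may depend on η.
ArbitrarilySmall : (ℚ → ℚ → Set) → Set
ArbitrarilySmall P = ∀ t → 0ℚ < t → ∃[ η ] ∃[ δ ] 0ℚ < η × η ≤ t × 0ℚ < δ × P η δ

-- For small η the sign is decided by c, and by e if c = 0. The first alternative is taken at δ = 0,
-- where d δ vanishes; in the second e η + c is strictly negative, so a small enough δ cannot make
-- up for it.
sign-for-small : ∀ u → Positive-for-small u ⊎
                 ArbitrarilySmall (λ η δ → ¬ Holds affine (η , δ , tt) u)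
sign-for-small (e , d , c) with <-cmp c 0ℚ
... | tri> _ _ c>0 with *-below (- e) c>0
...   | t , t>0 , small = inj₁ (t , t>0 , λ {η} η≥0 η≤t → subst (0ℚ ≤_)
          (solve 4 (λ c e d η → c :- (:- e) :* η := e :* η :+ (d :* con 0ℚ :+ c)) refl c e d η)
          (≤⇒0≤- (<⇒≤ (small η≥0 η≤t))))
sign-for-small (e , d , c) | tri≈ _ c≡0 _ with 0ℚ ≤? e
... | yes e≥0 = inj₁ (1ℚ , positive⁻¹ 1ℚ , λ {η} η≥0 _ → subst (0ℚ ≤_)
        (trans (solve 3 (λ e d η → e :* η := e :* η :+ (d :* con 0ℚ :+ con 0ℚ)) refl e d η)
          (cong (λ c → e * η + (d * 0ℚ + c)) (sym c≡0)))
        (0≤* e≥0 η≥0))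
... | no e≱0 = inj₂ λ t t>0 →
        let g>0 = 0<* (neg-antimono-< (≰⇒> e≱0)) t>0
            δ , δ>0 , small = *-below d g>0
        in t , δ , t>0 , ≤-refl , δ>0 , λ h → <⇒≱ (small (<⇒≤ δ>0) ≤-refl)
          (≤-from-gap h (trans (solve 4
            (λ e d t δ → d :* δ :- (:- e) :* t := e :* t :+ (d :* δ :+ con 0ℚ)) refl e d t δ)
              (cong (λ c → e * t + (d * δ + c)) (sym c≡0))))
sign-for-small (e , d , c) | tri< c<0 _ _ = inj₂ λ t t>0 →
  let s , s>0 , e-small = *-below e (neg-antimono-< c<0)
      η>0 = 0<-⊓ t>0 s>0
      δ , δ>0 , d-small = *-below d (<⇒0<- (e-small (<⇒≤ η>0) (p⊓q≤q t s)))
  in t ⊓ s , δ , η>0 , p⊓q≤p t s , δ>0 , λ h → <⇒≱ (d-small (<⇒≤ δ>0) ≤-refl)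
       (≤-from-gap h (solve 5
         (λ c e d η δ → d :* δ :- ((:- c) :- e :* η) := e :* η :+ (d :* δ :+ c)) refl c e d (t ⊓ s) δ))

-- One failing form makes the whole list fail. For the other alternative the induction keeps a
-- threshold below which every η works, so that the minimum of two thresholds serves both.
signs-for-small : ∀ us → (∃[ η ] 0ℚ < η × All (Holds affine (η , 0ℚ , tt)) us)
                       ⊎ ArbitrarilySmall (λ η δ → ¬ All (Holds affine (η , δ , tt)) us)
signs-for-small us with go us
  where
  go : ∀ us →
       (∃[ t ] 0ℚ < t × (∀ {η} → 0ℚ ≤ η → η ≤ t → All (Holds affine (η , 0ℚ , tt)) us))
       ⊎ ArbitrarilySmall (λ η δ → ¬ All (Holds affine (η , δ , tt)) us)
  go [] = inj₁ (1ℚ , positive⁻¹ 1ℚ , λ _ _ → [])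
  go (u ∷ us) with sign-for-small u | go us
  ... | inj₂ neg | _ = inj₂ λ t t>0 → let η , δ , η>0 , η≤t , δ>0 , ¬h = neg t t>0 in
        η , δ , η>0 , η≤t , δ>0 , λ { (h ∷ _) → ¬h h }
  ... | inj₁ _ | inj₂ neg = inj₂ λ t t>0 → let η , δ , η>0 , η≤t , δ>0 , ¬h = neg t t>0 in
        η , δ , η>0 , η≤t , δ>0 , λ { (_ ∷ h) → ¬h h }
  ... | inj₁ (s , s>0 , hu) | inj₁ (t , t>0 , hus) = inj₁ (s ⊓ t , 0<-⊓ s>0 t>0 ,
        λ η≥0 η≤ →
        hu η≥0 (≤-trans η≤ (p⊓q≤p s t)) ∷ hus η≥0 (≤-trans η≤ (p⊓q≤q s t)))
... | inj₁ (t , t>0 , h) = inj₁ (t , t>0 , h (<⇒≤ t>0) ≤-refl)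
... | inj₂ neg = inj₂ neg

Row : ℕ → Space → Set
Row k S = (Vec Bool k → ℚ) × Coef S

module _ (S : Space) {k} (ok : Vec Bool k → Bool) (rs : List (Row k S)) where
  open Space S using (_∙_)

  Feasible : Pt S → (Vec Bool k → ℚ) → Set
  Feasible p x = Supported ok x × All (λ (f , c) → 0ℚ ≤ Σ□ (λ σ → f σ * x σ) + c ∙ p) rs

  projection : List (Coef S)
  projection = eliminate k {S} ok (map (λ (f , c) → functional k f c) rs)

  feasible⇒projection : ∀ {p x} → Feasible p x → All (Holds S p) projection
  feasible⇒projection {p} {x} (supp , hs) =
    subst (λ p → All (Holds S p) projection) (base-point k {S} x p)
      (eliminate-sound k {S} ok _ {point k x p}
        (λ σ → subst (λ y → 0ℚ ≤ y × (ok σ ≡ false → y ≡ 0ℚ)) (sym (coord-point k {S} x p σ)) (supp σ))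
        (All.map⁺ (All.map (λ {(f , c)} → subst (0ℚ ≤_) (sym (trans (functional-∙ k {S} f c (point k {S} x p))
          (cong₂ _+_ (Σ□-cong (λ σ → cong (f σ *_) (coord-point k {S} x p σ)))
                     (cong (c ∙_) (base-point k {S} x p)))))) hs)))

  projection⇒feasible : ∀ {p} → All (Holds S p) projection → ∃[ x ] Feasible p x
  projection⇒feasible {p} hs with eliminate-complete k {S} ok _ hs
  ... | P , base≡ , supp , hrs = coord k {S} P , supp , All.map
        (λ {(f , c)} → subst (0ℚ ≤_) (trans (functional-∙ k {S} f c P)
          (cong (Σ□ (λ σ → f σ * coord k {S} P σ) +_) (cong (c ∙_) base≡)))) (All.map⁻ hrs)

-- Eliminating all x σ leaves finitely many affine conditions on η and δ alone, and elimination is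
-- exact in both directions.
feasible? : ∀ {k} (ok : Vec Bool k → Bool) (rs : List (Row k affine)) →
            (∃[ η ] 0ℚ < η × ∃[ x ] Feasible affine ok rs (η , 0ℚ , tt) x)
          ⊎ ArbitrarilySmall (λ η δ → ∀ x → ¬ Feasible affine ok rs (η , δ , tt) x)
feasible? ok rs with signs-for-small (projection affine ok rs)
... | inj₁ (η , η>0 , h) = inj₁ (η , η>0 , projection⇒feasible affine ok rs h)
... | inj₂ neg = inj₂ λ t t>0 → let η , δ , η>0 , η≤t , δ>0 , ¬h = neg t t>0 in
        η , δ , η>0 , η≤t , δ>0 , λ x → ¬h ∘ feasible⇒projection affine ok rs

-- Finite probabilistic trees

0≤val : ∀ r → 0ℚ ≤ val r
0≤val (q01 v h _) = recompute (0ℚ ≤? v) h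

val≤1 : ∀ r → val r ≤ 1ℚ
val≤1 (q01 v _ h) = recompute (v ≤? 1ℚ) h

Σ□-nonneg : ∀ {k} {x : Vec Bool k → ℚ} → (∀ σ → 0ℚ ≤ x σ) → 0ℚ ≤ Σ□ x
Σ□-nonneg {zero}  h = h []
Σ□-nonneg {suc k} h = 0≤+ (Σ□-nonneg (h ∘ (true ∷_))) (Σ□-nonneg (h ∘ (false ∷_)))

Σ□-mono : ∀ {k} {f g : Vec Bool k → ℚ} → (∀ σ → f σ ≤ g σ) → Σ□ f ≤ Σ□ g
Σ□-mono {zero}  h = h []
Σ□-mono {suc k} h = +-mono-≤ (Σ□-mono (h ∘ (true ∷_))) (Σ□-mono (h ∘ (false ∷_)))

Σ□-+ : ∀ k (f g : Vec Bool k → ℚ) → Σ□ (λ σ → f σ + g σ) ≡ Σ□ f + Σ□ g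
Σ□-+ zero  f g = refl
Σ□-+ (suc k) f g = trans
  (cong₂ _+_ (Σ□-+ k (f ∘ (true ∷_)) (g ∘ (true ∷_))) (Σ□-+ k (f ∘ (false ∷_)) (g ∘ (false ∷_))))
  (solve 4 (λ a b c d → (a :+ b) :+ (c :+ d) := (a :+ c) :+ (b :+ d)) refl
    (Σ□ (f ∘ (true ∷_))) (Σ□ (g ∘ (true ∷_))) (Σ□ (f ∘ (false ∷_))) (Σ□ (g ∘ (false ∷_))))

-- Children are indexed by sign vectors so that a solution of the linear system for the cells can
-- serve as the weights. A `leaf` is a looping state: it is its own successor and its own single
-- child, of weight 1.
data Tree : Set where
  leaf : Tree
  node : (ℕ → Bool) → Tree → ∀ k (w : Vec Bool k → ℚ) → (∀ σ → 0ℚ ≤ w σ) → Σ□ w ≡ 1ℚ →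
         (Vec Bool k → Tree) → Tree

label : Tree → ℕ → Bool
label leaf                   = λ _ → false
label (node ℓ _ _ _ _ _ _)   = ℓ

next : Tree → Tree
next leaf                    = leaf
next (node _ t _ _ _ _ _)    = t

arity : Tree → ℕ
arity leaf                   = 0
arity (node _ _ k _ _ _ _)   = k

weight : ∀ t → Vec Bool (arity t) → ℚ
weight leaf                  = λ _ → 1ℚ
weight (node _ _ _ w _ _ _)  = w

weight≥0 : ∀ t σ → 0ℚ ≤ weight t σ
weight≥0 leaf                = λ _ → nonNegative⁻¹ 1ℚ
weight≥0 (node _ _ _ _ h _ _) = h

weight-total : ∀ t → Σ□ (weight t) ≡ 1ℚ
weight-total leaf            = refl
weight-total (node _ _ _ _ _ h _) = h

child : ∀ t → Vec Bool (arity t) → Tree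
child leaf                   = λ _ → leaf
child (node _ _ _ _ _ _ c)   = c

mass : (Tree → Bool) → ∀ t → Vec Bool (arity t) → ℚ
mass P t σ = if P (child t σ) then weight t σ else 0ℚ

prob : (Tree → Bool) → Tree → ℚ
prob P t = Σ□ (mass P t)

sat : Form → Tree → Bool
sat (var i)  t = label t i
sat (¬' φ)   t = not (sat φ t)
sat (φ ∧' ψ) t = sat φ t ∧ sat ψ t
sat (L r φ)  t = does (val r ≤? prob (sat φ) t)
sat (○ φ)    t = sat φ (next t)

-- Soundness of the axioms and rules on trees

does⇒ : ∀ {A : Set} (a? : Dec A) → does a? ≡ true → A
does⇒ (yes a) _ = a

does⇏ : ∀ {A : Set} (a? : Dec A) → does a? ≡ false → ¬ A
does⇏ (no ¬a) _ = ¬a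

not-true : ∀ {b} → not b ≡ true → b ≡ false
not-true {false} _ = refl

⇒-intro : ∀ a {b} → (a ≡ true → b ≡ true) → not (a ∧ not b) ≡ true
⇒-intro false h = refl
⇒-intro true  h rewrite h refl = refl

⇒-elim : ∀ {a b} → not (a ∧ not b) ≡ true → a ≡ true → b ≡ true
⇒-elim {true} {true} _ _ = refl

∧-intro : ∀ {a b} → a ≡ true → b ≡ true → a ∧ b ≡ true
∧-intro refl refl = refl

⇔-intro : ∀ a b → a ≡ b → not (a ∧ not b) ∧ not (b ∧ not a) ≡ true
⇔-intro true  _ refl = refl
⇔-intro false _ refl = refl

eval-sat : ∀ φ t → eval (λ ψ → sat ψ t) φ ≡ sat φ t
eval-sat (var i)  t = refl
eval-sat (¬' φ)   t = cong not (eval-sat φ t)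
eval-sat (φ ∧' ψ) t = cong₂ _∧_ (eval-sat φ t) (eval-sat ψ t)
eval-sat (L r φ)  t = refl
eval-sat (○ φ)    t = refl

prob-nonneg : ∀ P t → 0ℚ ≤ prob P t
prob-nonneg P t = Σ□-nonneg pointwise
  where
  pointwise : ∀ σ → 0ℚ ≤ mass P t σ
  pointwise σ with P (child t σ)
  ... | true  = weight≥0 t σ
  ... | false = ≤-refl

prob-split : ∀ (P Q : Tree → Bool) t →
             prob P t ≡ prob (λ u → P u ∧ Q u) t + prob (λ u → P u ∧ not (Q u)) t
prob-split P Q t = trans (Σ□-cong (λ σ → pointwise (P (child t σ)) (Q (child t σ)) (weight t σ)))
  (Σ□-+ (arity t) (mass (λ u → P u ∧ Q u) t) (mass (λ u → P u ∧ not (Q u)) t))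
  where
  pointwise : ∀ a b w → (if a then w else 0ℚ) ≡
              (if a ∧ b then w else 0ℚ) + (if a ∧ not b then w else 0ℚ)
  pointwise false _     w = refl
  pointwise true  true  w = sym (+-identityʳ w)
  pointwise true  false w = sym (+-identityˡ w)

prob-not : ∀ P t → prob (not ∘ P) t + prob P t ≡ 1ℚ
prob-not P t = trans (sym (Σ□-+ (arity t) (mass (not ∘ P) t) (mass P t)))
  (trans (Σ□-cong (λ σ → pointwise (P (child t σ)) (weight t σ))) (weight-total t))
  where
  pointwise : ∀ a w → (if not a then w else 0ℚ) + (if a then w else 0ℚ) ≡ w
  pointwise true  w = +-identityˡ w
  pointwise false w = +-identityʳ w

-- Holds child by child, and yields `ax-K`: if the implication has probability 1, then P is at most
-- as probable as Q.
prob-⇒ : ∀ (P Q : Tree → Bool) t → prob (λ u → not (P u ∧ not (Q u))) t + prob P t ≤ 1ℚ + prob Q t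
prob-⇒ P Q t = subst₂ _≤_ (Σ□-+ (arity t) (mass (λ u → not (P u ∧ not (Q u))) t) (mass P t))
  (trans (Σ□-+ (arity t) (weight t) (mass Q t)) (cong (_+ prob Q t) (weight-total t)))
  (Σ□-mono (λ σ → pointwise (P (child t σ)) (Q (child t σ)) (weight≥0 t σ)))
  where
  pointwise : ∀ a b {w} → 0ℚ ≤ w →
              (if not (a ∧ not b) then w else 0ℚ) + (if a then w else 0ℚ) ≤ w + (if b then w else 0ℚ)
  pointwise true  true  {w} h = ≤-refl
  pointwise true  false {w} h = ≤-reflexive (+-comm 0ℚ w)
  pointwise false true  {w} h = +-monoʳ-≤ w h
  pointwise false false {w} h = ≤-refl

next^ : ℕ → Tree → Tree
next^ zero    t = t
next^ (suc n) t = next^ n (next t)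

sat-○^ : ∀ n φ t → sat (○^ n φ) t ≡ sat φ (next^ n t)
sat-○^ zero    φ t = refl
sat-○^ (suc n) φ t = sat-○^ n φ (next t)

L-true : ∀ r φ t → sat (L r φ) t ≡ true → val r ≤ prob (sat φ) t
L-true r φ t = does⇒ (val r ≤? prob (sat φ) t)

L-false : ∀ r φ t → sat (L r φ) t ≡ false → prob (sat φ) t < val r
L-false r φ t h = ≰⇒> (does⇏ (val r ≤? prob (sat φ) t) h)

true-L : ∀ r φ t → val r ≤ prob (sat φ) t → sat (L r φ) t ≡ true
true-L r φ t = dec-true (val r ≤? prob (sat φ) t)

false-L : ∀ r φ t → prob (sat φ) t < val r → sat (L r φ) t ≡ false
false-L r φ t h = dec-false (val r ≤? prob (sat φ) t) (<⇒≱ h)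

sound : ∀ {φ} → Thm φ → ∀ t → sat φ t ≡ true
sound {φ} (taut h) t = trans (sym (eval-sat φ t)) (h (λ ψ → sat ψ t))
sound ax-L0 t = true-L zero01 ⊥' t (prob-nonneg (sat ⊥') t)
sound (ax-neg r s φ 1<r+s) t = ⇒-intro (sat (L r (¬' φ)) t) λ hr → cong not (false-L s φ t (≰⇒> λ hs →
  <⇒≱ 1<r+s (subst (val r + val s ≤_) (prob-not (sat φ) t) (+-mono-≤ (L-true r (¬' φ) t hr) hs))))
sound (ax-add r s u φ ψ r+s≡u) t = ⇒-intro (sat (L r (φ ∧' ψ)) t ∧ sat (L s (φ ∧' ¬' ψ)) t) λ h →
  true-L u φ t (subst₂ _≤_ r+s≡u (sym (prob-split (sat φ) (sat ψ) t))
    (+-mono-≤ (L-true r (φ ∧' ψ) t (∧-conicalˡ _ _ h))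
              (L-true s (φ ∧' ¬' ψ) t (∧-conicalʳ (sat (L r (φ ∧' ψ)) t) _ h))))
sound (ax-sub r s u φ ψ r+s≡u) t = ⇒-intro (sat (¬' L r (φ ∧' ψ)) t ∧ sat (¬' L s (φ ∧' ¬' ψ)) t) λ h →
  cong not (false-L u φ t (subst₂ _<_ (sym (prob-split (sat φ) (sat ψ) t)) r+s≡u
    (+-mono-< (L-false r (φ ∧' ψ) t (not-true (∧-conicalˡ _ _ h)))
              (L-false s (φ ∧' ¬' ψ) t (not-true (∧-conicalʳ (sat (¬' L r (φ ∧' ψ)) t) _ h))))))
sound (ax-K r φ ψ) t = ⇒-intro (sat (L one01 (φ ⇒ ψ)) t) λ h₁ → ⇒-intro (sat (L r φ) t) λ hr →
  true-L r ψ t (≤-trans (L-true r φ t hr)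
    (≤-from-gap {prob (sat φ) t} {prob (sat ψ) t}
      (≤⇒0≤- (≤-trans (+-monoˡ-≤ (prob (sat φ) t) (L-true one01 (φ ⇒ ψ) t h₁)) (prob-⇒ (sat φ) (sat ψ) t)))
      (solve 2 (λ p q → q :- p := (con 1ℚ :+ q) :- (con 1ℚ :+ p)) refl (prob (sat φ) t) (prob (sat ψ) t))))
sound (ax-○¬ φ) t = ⇔-intro (sat (○ (¬' φ)) t) _ refl
sound (ax-○∧ φ ψ) t = ⇔-intro (sat (○ (φ ∧' ψ)) t) _ refl
sound (mp p q) t = ⇒-elim (sound p t) (sound q t)
sound (arch n r φ ψ h) t = ⇒-intro (sat ψ t) λ hψ →
  -- If the probability at `u` were below r, a rational strictly in between would be an index s < r
  -- whose premise fails.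
  trans (sat-○^ n (L r φ) t) (true-L r φ u (≮⇒≥ λ p<r →
    let q , p<q , q<r = <-dense p<r
        s = q01 q (≤-trans (prob-nonneg (sat φ) u) (<⇒≤ p<q)) (≤-trans (<⇒≤ q<r) (val≤1 r))
    in <⇒≱ p<q (L-true s φ u (trans (sym (sat-○^ n (L s φ) t)) (⇒-elim (sound (h s q<r) t) hψ)))))
  where
  u : Tree
  u = next^ n t
sound (nec-L {φ} h) t = true-L one01 φ t (≤-reflexive (trans (sym (weight-total t))
  (Σ□-cong λ σ → cong (λ b → if b then weight t σ else 0ℚ) (sym (sound h (child t σ))))))
sound (nec-○ h) t = sound h (next t)

-- Derived rules

⟦_⟧ : ℕ → ℚ
⟦ zero ⟧  = 0ℚ
⟦ suc n ⟧ = 1ℚ + ⟦ n ⟧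

toℚᵘ-⟦⟧ : ∀ n → toℚᵘ ⟦ n ⟧ ℚᵘ.≃ mkℚᵘ (ℤ.+ n) 0
toℚᵘ-⟦⟧ zero    = ℚᵘ.≃-refl
toℚᵘ-⟦⟧ (suc n) = ℚᵘ.≃-trans (toℚᵘ-homo-+ 1ℚ ⟦ n ⟧)
  (ℚᵘ.≃-trans (ℚᵘ.+-congʳ (mkℚᵘ (ℤ.+ 1) 0) (toℚᵘ-⟦⟧ n))
    (*≡* (cong (λ m → (ℤ.+ 1 ℤ.+ m) ℤ.* ℤ.+ 1) (ℤ.*-identityʳ (ℤ.+ n)))))

-- A fraction is bounded by the absolute value of its numerator, as the denominator is at least 1.
≤-⟦⟧ : ∀ p → ∃[ n ] p ≤ ⟦ n ⟧
≤-⟦⟧ p@(mkℚ a d _) = ℤ.∣ a ∣ , toℚᵘ-cancel-≤ (ℚᵘ.≤-respʳ-≃ (ℚᵘ.≃-sym (toℚᵘ-⟦⟧ ℤ.∣ a ∣)) (ℚᵘ.*≤* (scaled a)))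
  where
  scaled : ∀ a → a ℤ.* ℤ.+ 1 ℤ.≤ ℤ.+ ℤ.∣ a ∣ ℤ.* ℤ.+ suc d
  scaled (ℤ.+ n)    = ℤ.*-monoˡ-≤-nonNeg (ℤ.+ n) (ℤ.+≤+ (ℕ.s≤s ℕ.z≤n))
  scaled -[1+ n ] = ℤ.-≤+

archimedean : ∀ {δ} → 0ℚ < δ → ∃[ n ] 1ℚ ≤ ⟦ n ⟧ * δ
archimedean {δ} δ>0 with inverse δ>0
... | i , _ , δi≡1 with ≤-⟦⟧ i
... | n , i≤n = n , subst (_≤ ⟦ n ⟧ * δ) (trans (*-comm i δ) δi≡1)
  (*-monoʳ-≤-nonNeg δ {{nonNegative (<⇒≤ δ>0)}} i≤n)

infix 4 _⊢_
_⊢_ : Form → Form → Set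
γ ⊢ φ = Thm (γ ⇒ φ)

True : (Form → Bool) → Form → Set
True v φ = eval v φ ≡ true

-- Propositional steps are justified by valuations: the iterated implication from the premises is a
-- tautology, and the premises are detached by `mp`.
infer : ∀ {Γ φ} → All Thm Γ → (∀ v → All (True v) Γ → True v φ) → Thm φ
infer []       h = taut (λ v → h v [])
infer {γ ∷ Γ} (p ∷ ps) h = mp (infer {Γ} ps (λ v hs → ⇒-intro (eval v γ) (λ hγ → h v (hγ ∷ hs)))) p

⊢-infer : ∀ {Γ γ φ} → All (γ ⊢_) Γ → (∀ v → True v γ → All (True v) Γ → True v φ) → γ ⊢ φ
⊢-infer {[]} {γ} []      h = taut (λ v → ⇒-intro (eval v γ) (λ hγ → h v hγ []))
⊢-infer {ψ ∷ Γ} {γ} {φ} (p ∷ ps) h = infer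
  (p ∷ ⊢-infer {Γ} {γ} {ψ ⇒ φ} ps (λ v hγ hs → ⇒-intro (eval v ψ) (λ hψ → h v hγ (hψ ∷ hs))) ∷ [])
  λ { v (hp ∷ hi ∷ []) → ⇒-intro (eval v γ) (λ hγ → ⇒-elim (⇒-elim hi hγ) (⇒-elim hp hγ)) }

⊢-thm : ∀ {γ φ} → Thm φ → γ ⊢ φ
⊢-thm {γ} p = infer (p ∷ []) λ { v (h ∷ []) → ⇒-intro (eval v γ) (λ _ → h) }

⊢-refl : ∀ {γ} → γ ⊢ γ
⊢-refl = ⊢-infer [] λ v hγ _ → hγ

⊢-trans : ∀ {γ δ φ} → γ ⊢ δ → δ ⊢ φ → γ ⊢ φ
⊢-trans {γ} p q = infer (p ∷ q ∷ [])
  λ { v (h₁ ∷ h₂ ∷ []) → ⇒-intro (eval v γ) (λ hγ → ⇒-elim h₂ (⇒-elim h₁ hγ)) }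

⊢-mp : ∀ {γ φ ψ} → γ ⊢ φ ⇒ ψ → γ ⊢ φ → γ ⊢ ψ
⊢-mp p q = ⊢-infer (p ∷ q ∷ []) λ { v _ (h₁ ∷ h₂ ∷ []) → ⇒-elim h₁ h₂ }

∧⊢ˡ : ∀ {φ ψ} → φ ∧' ψ ⊢ φ
∧⊢ˡ = ⊢-infer [] λ v h _ → ∧-conicalˡ _ _ h

∧⊢ʳ : ∀ {φ ψ} → φ ∧' ψ ⊢ ψ
∧⊢ʳ {φ} = ⊢-infer [] λ v h _ → ∧-conicalʳ (eval v φ) _ h

Refuted : Form → Set
Refuted φ = Thm (¬' φ)

true≢false : ∀ {b} {A : Set} → b ≡ true → b ≡ false → A
true≢false refl ()

refute : ∀ {γ φ} → γ ⊢ φ → γ ⊢ ¬' φ → Refuted γ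
refute {γ} {φ} p q = infer (p ∷ q ∷ [])
  λ { v (h₁ ∷ h₂ ∷ []) → cong not (¬-not λ hγ → true≢false (⇒-elim h₁ hγ) (not-true (⇒-elim h₂ hγ))) }

by-cases : ∀ {γ} φ → Refuted (γ ∧' φ) → Refuted (γ ∧' ¬' φ) → Refuted γ
by-cases {γ} φ p q = infer (p ∷ q ∷ []) λ { v (h₁ ∷ h₂ ∷ []) → go (eval v γ) (eval v φ) h₁ h₂ }
  where
  go : ∀ a b → not (a ∧ b) ≡ true → not (a ∧ not b) ≡ true → not a ≡ true
  go false _     _ _ = refl
  go true  true  () _
  go true  false _ ()

⊤' : Form
⊤' = ¬' ⊥'

True-⊤ : ∀ v → True v ⊤'
True-⊤ v = cong not (∧-inverseʳ (v (var 0)))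

Q01-≡ : ∀ {r s} → val r ≡ val s → r ≡ s
Q01-≡ {q01 _ _ _} {q01 _ _ _} refl = refl

L-mono : ∀ {γ φ ψ} r → φ ⊢ ψ → γ ⊢ L r φ → γ ⊢ L r ψ
L-mono {φ = φ} {ψ} r p q = ⊢-mp (⊢-thm (mp (ax-K r φ ψ) (nec-L p))) q

L-contra : ∀ {γ φ ψ} r → φ ⊢ ψ → γ ⊢ ¬' L r ψ → γ ⊢ ¬' L r φ
L-contra {φ = φ} {ψ} r p q = ⊢-infer (⊢-thm (mp (ax-K r φ ψ) (nec-L p)) ∷ q ∷ [])
  λ { v _ (h₁ ∷ h₂ ∷ []) → cong not (¬-not λ h → true≢false (⇒-elim h₁ h) (not-true h₂)) }

⊢L0 : ∀ {γ} φ → γ ⊢ L zero01 φ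
⊢L0 φ = L-mono zero01 (⊢-infer [] λ v h _ → true≢false h (∧-inverseʳ (v (var 0)))) (⊢-thm ax-L0)

-- `nec-L` gives the negation of φ probability 1, and 1 + r > 1 makes `ax-neg` applicable.
⊢¬L : ∀ {γ φ} r → Refuted φ → 0ℚ < val r → γ ⊢ ¬' L r φ
⊢¬L {φ = φ} r p r>0 = ⊢-thm (mp
  (ax-neg one01 r φ (subst (_< 1ℚ + val r) (+-identityʳ 1ℚ) (+-monoʳ-< 1ℚ r>0))) (nec-L p))

∧-contradictory : ∀ φ → Refuted (φ ∧' ¬' φ)
∧-contradictory φ = taut λ v → cong not (∧-inverseʳ (eval v φ))

∸01 : ∀ r x → 0ℚ ≤ x → x ≤ val r → ∃[ s ] val s ≡ val r - x
∸01 r x x≥0 x≤r = q01 (val r - x) (≤⇒0≤- x≤r)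
  (≤-trans (≤-from-gap x≥0 (solve 2 (λ r x → r :- (r :- x) := x) refl (val r) x)) (val≤1 r)) , refl

+-cancel-∸ : ∀ x r → x + (r - x) ≡ r
+-cancel-∸ = solve 2 (λ x r → x :+ (r :- x) := r) refl

-- `ax-sub` with φ split by itself: `L t` fails for the contradiction φ ∧ ¬φ since t > 0, so `L r φ`
-- forces `L s` of φ ∧ φ.
L-antitone-+ : ∀ {γ φ} r s t → val s + val t ≡ val r → 0ℚ < val t → γ ⊢ L r φ → γ ⊢ L s φ
L-antitone-+ {γ} {φ} r s t s+t≡r t>0 p = ⊢-infer
  ( ⊢-thm (ax-sub s t r φ φ s+t≡r)
  ∷ ⊢¬L t (∧-contradictory φ) t>0
  ∷ ⊢-thm (mp (ax-K s (φ ∧' φ) φ) (nec-L ∧⊢ˡ))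
  ∷ p ∷ [])
  λ { v _ (h₁ ∷ h₂ ∷ h₃ ∷ h₄ ∷ []) →
    go (v (L s (φ ∧' φ))) (not (v (L t (φ ∧' ¬' φ)))) (v (L r φ)) (v (L s φ)) h₁ h₂ h₃ h₄ }
  where
  go : ∀ a b c d → not ((not a ∧ b) ∧ not (not c)) ≡ true → b ≡ true →
       not (a ∧ not d) ≡ true → c ≡ true → d ≡ true
  go _     _    _    true  _  _ _  _ = refl
  go true  _    _    false _  _ () _
  go false true true false () _ _  _

L-antitone : ∀ {γ φ} r s → val s ≤ val r → γ ⊢ L r φ → γ ⊢ L s φ
L-antitone {γ} {φ} r s s≤r p with <-cmp (val s) (val r)
... | tri≈ _ s≡r _ = subst (λ q → γ ⊢ L q φ) (Q01-≡ (sym s≡r)) p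
... | tri> _ _ r<s = contradiction s≤r (<⇒≱ r<s)
... | tri< s<r _ _ = let t , t≡ = ∸01 r (val s) (0≤val s) s≤r in
  L-antitone-+ r s t (trans (cong (val s +_) t≡) (+-cancel-∸ (val s) (val r)))
    (subst (0ℚ <_) (sym t≡) (<⇒0<- s<r)) p

-- "φ has probability at least x" and "less than y", for rational x and y that need not lie in [0,1].
Lo Hi : Form → ℚ → Form → Set
Lo γ x φ = ∀ r → val r ≤ x → γ ⊢ L r φ
Hi γ y φ = ∀ r → y ≤ val r → γ ⊢ ¬' L r φ

L⇒Lo : ∀ {γ φ} r → γ ⊢ L r φ → Lo γ (val r) φ
L⇒Lo r p s s≤r = L-antitone r s s≤r p

¬L⇒Hi : ∀ {γ φ} r → γ ⊢ ¬' L r φ → Hi γ (val r) φ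
¬L⇒Hi {γ} {φ} r p s r≤s = ⊢-infer (r⇒s ∷ p ∷ [])
  λ { v hγ (h₁ ∷ h₂ ∷ []) → cong not (¬-not λ h → true≢false (⇒-elim h₁ h) (not-true h₂)) }
  where
  r⇒s : γ ⊢ L s φ ⇒ L r φ
  r⇒s = ⊢-thm (L-antitone s r r≤s ⊢-refl)

Lo-zero : ∀ {γ φ} → Lo γ 0ℚ φ
Lo-zero {γ} {φ} r r≤0 = subst (λ q → γ ⊢ L q φ) (Q01-≡ (≤-antisym (0≤val r) r≤0)) (⊢L0 φ)

Hi-refuted : ∀ {γ φ y} → Refuted φ → 0ℚ < y → Hi γ y φ
Hi-refuted p y>0 r y≤r = ⊢¬L r p (<-≤-trans y>0 y≤r)

Lo-mono : ∀ {γ φ ψ x} → φ ⊢ ψ → Lo γ x φ → Lo γ x ψ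
Lo-mono p h r r≤x = L-mono r p (h r r≤x)

Hi-mono : ∀ {γ φ ψ y} → φ ⊢ ψ → Hi γ y ψ → Hi γ y φ
Hi-mono p h r y≤r = L-contra r p (h r y≤r)

Lo-weaken : ∀ {γ δ φ x} → δ ⊢ γ → Lo γ x φ → Lo δ x φ
Lo-weaken p h r r≤x = ⊢-trans p (h r r≤x)

Hi-weaken : ∀ {γ δ φ y} → δ ⊢ γ → Hi γ y φ → Hi δ y φ
Hi-weaken p h r y≤r = ⊢-trans p (h r y≤r)

⊢∧ : ∀ {γ φ ψ} → γ ⊢ φ → γ ⊢ ψ → γ ⊢ φ ∧' ψ
⊢∧ p q = ⊢-infer (p ∷ q ∷ []) λ { v _ (h₁ ∷ h₂ ∷ []) → ∧-intro h₁ h₂ }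

≤-∸ : ∀ x y r → r ≤ x + y → r - x ≤ y
≤-∸ x y r h = ≤-from-gap (≤⇒0≤- h) (solve 3 (λ x y r → y :- (r :- x) := (x :+ y) :- r) refl x y r)

∸-≤ : ∀ x y r → x + y ≤ r → y ≤ r - x
∸-≤ x y r h = ≤-from-gap (≤⇒0≤- h) (solve 3 (λ x y r → (r :- x) :- y := r :- (x :+ y)) refl x y r)

split01 : ∀ r x → 0ℚ ≤ x → x ≤ val r →
          ∃[ q ] ∃[ s ] val q ≡ x × val s ≡ val r - x × val q + val s ≡ val r
split01 r x x≥0 x≤r = let s , s≡ = ∸01 r x x≥0 x≤r in
  q01 x x≥0 (≤-trans x≤r (val≤1 r)) , s , refl , s≡ , trans (cong (x +_) s≡) (+-cancel-∸ x (val r))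

-- An index r ≤ x + y is either at most x, hence reached by π ∧ ψ alone, or it is x plus a remainder
-- at most y. In the latter case x ≤ r ≤ 1, so x is itself an index and `ax-add` applies.
Lo-add : ∀ {γ π} ψ {x y} → 0ℚ ≤ x → 0ℚ ≤ y → Lo γ x (π ∧' ψ) → Lo γ y (π ∧' ¬' ψ) → Lo γ (x + y) π
Lo-add {γ} {π} ψ {x} {y} x≥0 y≥0 hx hy r r≤x+y with ≤-total (val r) x
... | inj₁ r≤x = L-mono r ∧⊢ˡ (hx r r≤x)
... | inj₂ x≤r = let q , s , q≡ , s≡ , q+s≡r = split01 r x x≥0 x≤r in
  ⊢-mp (⊢-thm (ax-add q s r π ψ q+s≡r))
    (⊢∧ (hx q (≤-reflexive q≡)) (hy s (subst (_≤ y) (sym s≡) (≤-∸ x y (val r) r≤x+y))))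

Hi-add : ∀ {γ π} ψ {x y} → 0ℚ ≤ x → 0ℚ ≤ y → Hi γ x (π ∧' ψ) → Hi γ y (π ∧' ¬' ψ) → Hi γ (x + y) π
Hi-add {γ} {π} ψ {x} {y} x≥0 y≥0 hx hy r x+y≤r =
  let q , s , q≡ , s≡ , q+s≡r = split01 r x x≥0 x≤r in
  ⊢-mp (⊢-thm (ax-sub q s r π ψ q+s≡r))
    (⊢∧ (hx q (≤-reflexive (sym q≡))) (hy s (subst (y ≤_) (sym s≡) (∸-≤ x y (val r) x+y≤r))))
  where
  x≤r : x ≤ val r
  x≤r = ≤-trans (subst (_≤ x + y) (+-identityʳ x) (+-monoʳ-≤ x y≥0)) x+y≤r

-- `ax-add` cannot express a sum beyond 1; the excess is contradicted by `ax-neg`, after weakening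
-- the two parts to ψ and ¬ψ.
Lo-over : ∀ {γ π} ψ {x y} → 0ℚ ≤ x → x ≤ 1ℚ → 0ℚ ≤ y → y ≤ 1ℚ → 1ℚ < x + y →
          Lo γ x (π ∧' ψ) → Lo γ y (π ∧' ¬' ψ) → Refuted γ
Lo-over {γ} {π} ψ {x} {y} x≥0 x≤1 y≥0 y≤1 1<x+y hx hy =
  refute (L-mono q ∧⊢ʳ (hx q ≤-refl))
    (⊢-mp (⊢-thm (ax-neg s q ψ (subst (1ℚ <_) (+-comm x y) 1<x+y))) (L-mono s ∧⊢ʳ (hy s ≤-refl)))
  where
  q s : Q01
  q = q01 x x≥0 x≤1
  s = q01 y y≥0 y≤1

-- Cells and bounds on their probabilities

sgn : Bool → Form → Form
sgn true  φ = φ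
sgn false φ = ¬' φ

-- With π as an accumulator, each recursive step passes from π to π ∧ ψ or π ∧ ¬ψ, which are the two
-- parts in `ax-add` and `ax-sub`.
cell : ∀ {k} → Form → Vec Form k → Vec Bool k → Form
cell π []      []      = π
cell π (ψ ∷ Ψ) (b ∷ σ) = cell (π ∧' sgn b ψ) Ψ σ

Lo-Σ□ : ∀ {k γ} π (Ψ : Vec Form k) {x} → (∀ σ → 0ℚ ≤ x σ) →
        (∀ σ → Lo γ (x σ) (cell π Ψ σ)) → Lo γ (Σ□ x) π
Lo-Σ□ π []      x≥0 h = h []
Lo-Σ□ π (ψ ∷ Ψ) x≥0 h = Lo-add ψ (Σ□-nonneg (x≥0 ∘ (true ∷_))) (Σ□-nonneg (x≥0 ∘ (false ∷_)))
  (Lo-Σ□ (π ∧' ψ) Ψ (x≥0 ∘ (true ∷_)) (h ∘ (true ∷_)))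
  (Lo-Σ□ (π ∧' ¬' ψ) Ψ (x≥0 ∘ (false ∷_)) (h ∘ (false ∷_)))

Hi-Σ□ : ∀ {k γ} π (Ψ : Vec Form k) {x} → (∀ σ → 0ℚ ≤ x σ) →
        (∀ σ → Hi γ (x σ) (cell π Ψ σ)) → Hi γ (Σ□ x) π
Hi-Σ□ π []      x≥0 h = h []
Hi-Σ□ π (ψ ∷ Ψ) x≥0 h = Hi-add ψ (Σ□-nonneg (x≥0 ∘ (true ∷_))) (Σ□-nonneg (x≥0 ∘ (false ∷_)))
  (Hi-Σ□ (π ∧' ψ) Ψ (x≥0 ∘ (true ∷_)) (h ∘ (true ∷_)))
  (Hi-Σ□ (π ∧' ¬' ψ) Ψ (x≥0 ∘ (false ∷_)) (h ∘ (false ∷_)))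

-- Descends into a half whose sum exceeds 1 until both halves are at most 1 while together they
-- exceed it; there `Lo-over` applies. A single cell never exceeds 1.
Σ□-over : ∀ {k γ} π (Ψ : Vec Form k) {x} → (∀ σ → 0ℚ ≤ x σ) → (∀ σ → x σ ≤ 1ℚ) →
          (∀ σ → Lo γ (x σ) (cell π Ψ σ)) → 1ℚ < Σ□ x → Refuted γ
Σ□-over π [] x≥0 x≤1 h over = contradiction (x≤1 []) (<⇒≱ over)
Σ□-over π (ψ ∷ Ψ) {x} x≥0 x≤1 h over
  with Σ□ (x ∘ (true ∷_)) ≤? 1ℚ | Σ□ (x ∘ (false ∷_)) ≤? 1ℚ
... | no ≰1 | _ = Σ□-over (π ∧' ψ) Ψ (x≥0 ∘ (true ∷_)) (x≤1 ∘ (true ∷_)) (h ∘ (true ∷_)) (≰⇒> ≰1)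
... | yes _ | no ≰1 = Σ□-over (π ∧' ¬' ψ) Ψ (x≥0 ∘ (false ∷_)) (x≤1 ∘ (false ∷_)) (h ∘ (false ∷_)) (≰⇒> ≰1)
... | yes ≤1 | yes ≤1′ = Lo-over {π = π} ψ
  (Σ□-nonneg (x≥0 ∘ (true ∷_))) ≤1 (Σ□-nonneg (x≥0 ∘ (false ∷_))) ≤1′ over
  (Lo-Σ□ (π ∧' ψ) Ψ (x≥0 ∘ (true ∷_)) (h ∘ (true ∷_)))
  (Lo-Σ□ (π ∧' ¬' ψ) Ψ (x≥0 ∘ (false ∷_)) (h ∘ (false ∷_)))

eval-sgn : ∀ v b φ → True v (sgn b φ) → eval v φ ≡ b
eval-sgn v true  φ h = h
eval-sgn v false φ h = not-true h

sgn-eval : ∀ v b φ → eval v φ ≡ b → True v (sgn b φ)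
sgn-eval v true  φ h = h
sgn-eval v false φ h = cong not h

Matches : ∀ {k} → (Form → Bool) → Vec Form k → Vec Bool k → Set
Matches v Ψ σ = ∀ i → eval v (lookup Ψ i) ≡ lookup σ i

True-cell⁻ : ∀ {k} v π (Ψ : Vec Form k) σ → True v (cell π Ψ σ) → True v π × Matches v Ψ σ
True-cell⁻ v π []      []      h = h , λ ()
True-cell⁻ v π (ψ ∷ Ψ) (b ∷ σ) h with True-cell⁻ v (π ∧' sgn b ψ) Ψ σ h
... | hπ∧ψ , m = ∧-conicalˡ _ _ hπ∧ψ ,
  λ { zero → eval-sgn v b ψ (∧-conicalʳ (eval v π) _ hπ∧ψ) ; (suc i) → m i }

True-cell⁺ : ∀ {k} v π (Ψ : Vec Form k) σ → True v π → Matches v Ψ σ → True v (cell π Ψ σ)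
True-cell⁺ v π []      []      h m = h
True-cell⁺ v π (ψ ∷ Ψ) (b ∷ σ) h m =
  True-cell⁺ v (π ∧' sgn b ψ) Ψ σ (∧-intro h (sgn-eval v b ψ (m zero))) (m ∘ suc)

-- Under γ the probability of φ lies in the interval from x (included) to x + δ (excluded). The
-- field `null` supplies the support condition of the linear system.
record Approx (possible : Bool) (δ : ℚ) (γ φ : Form) (x : ℚ) : Set where
  constructor approx
  field
    ≥0   : 0ℚ ≤ x
    ≤1   : x ≤ 1ℚ
    null  : possible ≡ false → x ≡ 0ℚ
    low  : Lo γ x φ
    high : Hi γ (x + δ) φ

Approx-weaken : ∀ {b δ γ γ′ φ x} → γ′ ⊢ γ → Approx b δ γ φ x → Approx b δ γ′ φ x
Approx-weaken p (approx a b c d e) = approx a b c (Lo-weaken p d) (Hi-weaken p e)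

module _ {δ : ℚ} (δ>0 : 0ℚ < δ) where

  -- The continuation has to refute every extension of γ in which an approximation is fixed. The
  -- search raises x in steps of δ by cases on `L (x + δ) φ`: the negative case fixes x, the
  -- positive one goes on from x + δ, with 1 ≤ x + n δ as invariant.
  approximate : ∀ b φ → (b ≡ false → Refuted φ) → ∀ γ →
                (∀ γ′ x → γ′ ⊢ γ → Approx b δ γ′ φ x → Refuted γ′) → Refuted γ
  approximate false φ ref γ cont = cont γ 0ℚ ⊢-refl
    (approx ≤-refl (nonNegative⁻¹ 1ℚ) (λ _ → refl) Lo-zero
      (Hi-refuted (ref refl) (subst (0ℚ <_) (sym (+-identityˡ δ)) δ>0)))
  approximate true φ _ γ cont =
    let n , 1≤nδ = archimedean δ>0 in
    search n 0ℚ γ ≤-refl (nonNegative⁻¹ 1ℚ) (subst (1ℚ ≤_) (sym (+-identityˡ _)) 1≤nδ) ⊢-refl Lo-zero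
    where
    search : ∀ n x γ′ → 0ℚ ≤ x → x ≤ 1ℚ → 1ℚ ≤ x + ⟦ n ⟧ * δ → γ′ ⊢ γ → Lo γ′ x φ → Refuted γ′
    search n x γ′ x≥0 x≤1 fuel p lo with x + δ ≤? 1ℚ
    -- No index in [0,1] reaches x + δ, so the upper bound is vacuous.
    ... | no x+δ≰1 = cont γ′ x p (approx x≥0 x≤1 (λ ()) lo
          (λ r x+δ≤r → contradiction (≤-trans x+δ≤r (val≤1 r)) x+δ≰1))
    search zero x γ′ x≥0 x≤1 fuel p lo | yes x+δ≤1 = contradiction (≤-trans x+δ≤1 fuel)
      (<⇒≱ (+-monoʳ-< x (subst (_< δ) (sym (*-zeroˡ δ)) δ>0)))
    search (suc n) x γ′ x≥0 x≤1 fuel p lo | yes x+δ≤1 = by-cases (L r φ)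
      (search n (x + δ) (γ′ ∧' L r φ) (val≥0) x+δ≤1
        (≤-trans fuel (≤-reflexive (solve 3
          (λ x n δ → x :+ (con 1ℚ :+ n) :* δ := (x :+ δ) :+ n :* δ) refl x ⟦ n ⟧ δ)))
        (⊢-trans ∧⊢ˡ p) (L⇒Lo r ∧⊢ʳ))
      (cont (γ′ ∧' ¬' L r φ) x (⊢-trans ∧⊢ˡ p)
        (approx x≥0 x≤1 (λ ()) (Lo-weaken ∧⊢ˡ lo) (¬L⇒Hi r ∧⊢ʳ)))
      where
      val≥0 : 0ℚ ≤ x + δ
      val≥0 = 0≤+ x≥0 (<⇒≤ δ>0)
      r : Q01
      r = q01 (x + δ) val≥0 x+δ≤1

  approximate-cells : ∀ k (ok : Vec Bool k → Bool) (c : Vec Bool k → Form) →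
    (∀ σ → ok σ ≡ false → Refuted (c σ)) → ∀ γ →
    (∀ γ′ (x : Vec Bool k → ℚ) → γ′ ⊢ γ → (∀ σ → Approx (ok σ) δ γ′ (c σ) (x σ)) → Refuted γ′) → Refuted γ
  approximate-cells zero ok c ref γ cont = approximate (ok []) (c []) (ref []) γ
    λ γ′ x p a → cont γ′ (λ _ → x) p λ { [] → a }
  approximate-cells (suc k) ok c ref γ cont =
    approximate-cells k (ok ∘ (true ∷_)) (c ∘ (true ∷_)) (ref ∘ (true ∷_)) γ λ γ₁ x₁ p₁ a₁ →
    approximate-cells k (ok ∘ (false ∷_)) (c ∘ (false ∷_)) (ref ∘ (false ∷_)) γ₁ λ γ₂ x₂ p₂ a₂ →
    cont γ₂ (λ { (true ∷ σ) → x₁ σ ; (false ∷ σ) → x₂ σ }) (⊢-trans p₂ p₁)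
      λ { (true ∷ σ) → Approx-weaken p₂ (a₁ σ) ; (false ∷ σ) → a₂ σ }

literal : ∀ {k} → Vec Bool k → Vec Q01 k → Vec Form k → Fin k → Form
literal τ R Ψ i = sgn (lookup τ i) (L (lookup R i) (lookup Ψ i))

-- The only use of `arch` in a derivation. If γ ∧ ¬ L s ψ is refuted for each s < r, then γ proves
-- every such `L s ψ`, hence `L r ψ`, against the literal ¬ L r ψ. So it suffices to refute
-- extensions in which every negated literal holds with a positive margin.
strengthen : ∀ {k} τ R (Ψ : Vec Form k) γ → (∀ i → γ ⊢ literal τ R Ψ i) →
  (∀ γ′ η → γ′ ⊢ γ → 0ℚ < η →
    (∀ i → lookup τ i ≡ false → Hi γ′ (val (lookup R i) - η) (lookup Ψ i)) → Refuted γ′) →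
  Refuted γ
-- With no literals left any positive margin will do.
strengthen [] [] [] γ lits cont = cont γ 1ℚ ⊢-refl (positive⁻¹ 1ℚ) λ ()
strengthen (true ∷ τ) (r ∷ R) (ψ ∷ Ψ) γ lits cont =
  strengthen τ R Ψ γ (lits ∘ suc) λ γ′ η p η>0 his →
  cont γ′ η p η>0 λ { zero () ; (suc i) → his i }
strengthen (false ∷ τ) (r ∷ R) (ψ ∷ Ψ) γ lits cont = refute
  (arch 0 r ψ γ λ s s<r →
    -- Refuted (γ ∧' ¬' L s ψ) unfolds to γ ⊢ L s ψ.
    (strengthen τ R Ψ (γ ∧' ¬' L s ψ) (⊢-trans ∧⊢ˡ ∘ lits ∘ suc) λ γ′ η p η>0 his →
      -- A common margin: r - m ≥ s serves the new literal, and m ≤ η the remaining ones.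
      let m = (val r - val s) ⊓ η in
      cont γ′ m (⊢-trans p ∧⊢ˡ) (0<-⊓ (<⇒0<- s<r) η>0)
        λ { zero _ q hq → ¬L⇒Hi s (⊢-trans p ∧⊢ʳ) q
              (≤-trans (≤-from-gap (≤⇒0≤- (p⊓q≤p (val r - val s) η))
                (solve 3 (λ r s m → (r :- m) :- s := (r :- s) :- m) refl (val r) (val s) m)) hq)
          ; (suc i) e q hq → his i e q
              (≤-trans (+-monoʳ-≤ (val (lookup R i)) (neg-antimono-≤ (p⊓q≤q (val r - val s) η))) hq) }))
  (lits zero)

-- The linear system of a set of L-literals

ind : Bool → ℚ
ind true  = 1ℚ
ind false = 0ℚ

total : ∀ {k} → (Vec Bool k → Bool) → (Vec Bool k → ℚ) → ℚ
total ρ x = Σ□ (λ σ → ind (ρ σ) * x σ)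

-- This is 2^k, the number of cells, and so the factor by which an error of δ per cell accumulates.
volume : ℕ → ℚ
volume k = Σ□ {k} (λ _ → 1ℚ)

Σ□-const : ∀ k δ → Σ□ {k} (λ _ → δ) ≡ volume k * δ
Σ□-const zero    δ = sym (*-identityˡ δ)
Σ□-const (suc k) δ = trans (cong₂ _+_ (Σ□-const k δ) (Σ□-const k δ)) (sym (*-distribʳ-+ δ (volume k) (volume k)))

Σ□-neg : ∀ {k} (f x : Vec Bool k → ℚ) → Σ□ (λ σ → - f σ * x σ) ≡ - Σ□ (λ σ → f σ * x σ)
Σ□-neg {zero}  f x = sym (neg-distribˡ-* (f []) (x []))
Σ□-neg {suc k} f x = trans
  (cong₂ _+_ (Σ□-neg (f ∘ (true ∷_)) (x ∘ (true ∷_))) (Σ□-neg (f ∘ (false ∷_)) (x ∘ (false ∷_))))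
  (sym (neg-distrib-+ (Σ□ (λ σ → f (true ∷ σ) * x (true ∷ σ))) (Σ□ (λ σ → f (false ∷ σ) * x (false ∷ σ)))))

-- Stands for `total ρ x ≤ s - e * η`: e = 1 turns a strict inequality into one with margin η, and e
-- = 0 leaves it non-strict.
atMost : ∀ {k} → (Vec Bool k → Bool) → ℚ → ℚ → Row k affine
atMost ρ s e = (λ σ → - ind (ρ σ)) , (- e , 0ℚ , s)

-- Approximations are taken from below, so a total may fall short of r by up to δ per cell. Lower
-- bounds therefore get slack in δ, and upper bounds get none.
atLeast : ∀ {k} → (Vec Bool k → Bool) → ℚ → Row k affine
atLeast {k} ρ r = (λ σ → ind (ρ σ)) , (0ℚ , volume k , - r)

RowHolds : ∀ {k} → ℚ → ℚ → (Vec Bool k → ℚ) → Row k affine → Set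
RowHolds η δ x (f , c) = 0ℚ ≤ Σ□ (λ σ → f σ * x σ) + Space._∙_ affine c (η , δ , tt)

module _ {k} (ρ : Vec Bool k → Bool) (η δ : ℚ) (x : Vec Bool k → ℚ) where

  atMost-value : ∀ s e → Σ□ (λ σ → - ind (ρ σ) * x σ) + (- e * η + (0ℚ * δ + s)) ≡ (s - e * η) - total ρ x
  atMost-value s e = trans (cong (_+ (- e * η + (0ℚ * δ + s))) (Σ□-neg (ind ∘ ρ) x))
    (solve 5
      (λ S e η δ s → (:- S) :+ ((:- e) :* η :+ (con 0ℚ :* δ :+ s)) := (s :- e :* η) :- S) refl (total ρ x) e η δ s)

  atMost⁺ : ∀ s e → total ρ x ≤ s - e * η → RowHolds η δ x (atMost ρ s e)
  atMost⁺ s e h = subst (0ℚ ≤_) (sym (atMost-value s e)) (≤⇒0≤- h)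

  atMost⁻ : ∀ s e → RowHolds η δ x (atMost ρ s e) → total ρ x ≤ s - e * η
  atMost⁻ s e h = 0≤-⇒≤ (subst (0ℚ ≤_) (atMost-value s e) h)

  atLeast-value : ∀ r → total ρ x + (0ℚ * η + (volume k * δ + - r)) ≡ (total ρ x + volume k * δ) - r
  atLeast-value r = solve 5 (λ S η K δ r → S :+ (con 0ℚ :* η :+ (K :* δ :+ (:- r))) := (S :+ K :* δ) :- r)
    refl (total ρ x) η (volume k) δ r

  atLeast⁺ : ∀ r → r ≤ total ρ x + volume k * δ → RowHolds η δ x (atLeast ρ r)
  atLeast⁺ r h = subst (0ℚ ≤_) (sym (atLeast-value r)) (≤⇒0≤- h)

  atLeast⁻ : ∀ r → RowHolds η δ x (atLeast ρ r) → r ≤ total ρ x + volume k * δ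
  atLeast⁻ r h = 0≤-⇒≤ (subst (0ℚ ≤_) (atLeast-value r) h)

-- The clash needs an index in [0,1] between y and x: x itself, or 1 if x is larger.
Lo-Hi-refute : ∀ {γ φ x y} → 0ℚ ≤ x → y ≤ 1ℚ → y ≤ x → Lo γ x φ → Hi γ y φ → Refuted γ
Lo-Hi-refute {γ} {φ} {x} {y} x≥0 y≤1 y≤x lo hi with ≤-total x 1ℚ
... | inj₁ x≤1 = refute (lo (q01 x x≥0 x≤1) ≤-refl) (hi (q01 x x≥0 x≤1) y≤x)
... | inj₂ 1≤x = refute (lo one01 1≤x) (hi one01 y≤1)

-- `ρ` selects the cells that make up χ. Stated by valuations, this covers both the members of Ψ and
-- `⊤'`.
Determines : ∀ {k} → Vec Form k → Form → (Vec Bool k → Bool) → Set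
Determines Ψ χ ρ = ∀ v σ → Matches v Ψ σ → eval v χ ≡ ρ σ

module _ {k} (Ψ : Vec Form k) {χ : Form} {ρ : Vec Bool k → Bool} (det : Determines Ψ χ ρ) where

  cell-in : ∀ σ → ρ σ ≡ true → cell ⊤' Ψ σ ⊢ cell χ Ψ σ
  cell-in σ e = ⊢-infer [] λ v h _ → let m = proj₂ (True-cell⁻ v ⊤' Ψ σ h) in
    True-cell⁺ v χ Ψ σ (trans (det v σ m) e) m

  cell-⊤ : ∀ σ → cell χ Ψ σ ⊢ cell ⊤' Ψ σ
  cell-⊤ σ = ⊢-infer [] λ v h _ → True-cell⁺ v ⊤' Ψ σ (True-⊤ v) (proj₂ (True-cell⁻ v χ Ψ σ h))

  cell-out : ∀ σ → ρ σ ≡ false → Refuted (cell χ Ψ σ)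
  cell-out σ e = taut λ v → cong not (¬-not λ h → let hχ , m = True-cell⁻ v χ Ψ σ h in
    true≢false hχ (trans (det v σ m) e))

  module _ {γ δ} {ok : Vec Bool k → Bool} {x : Vec Bool k → ℚ} (δ>0 : 0ℚ < δ)
           (a : ∀ σ → Approx (ok σ) δ γ (cell ⊤' Ψ σ) (x σ)) where

    ind*-nonneg : ∀ b σ → 0ℚ ≤ ind b * x σ
    ind*-nonneg true  σ = 0≤* (nonNegative⁻¹ 1ℚ) (Approx.≥0 (a σ))
    ind*-nonneg false σ = 0≤* (≤-refl {0ℚ}) (Approx.≥0 (a σ))

    Lo-cell : ∀ σ b → ρ σ ≡ b → Lo γ (ind b * x σ) (cell χ Ψ σ)
    Lo-cell σ true  e = subst (λ y → Lo γ y (cell χ Ψ σ)) (sym (*-identityˡ (x σ)))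
      (Lo-mono (cell-in σ e) (Approx.low (a σ)))
    Lo-cell σ false e = subst (λ y → Lo γ y (cell χ Ψ σ)) (sym (*-zeroˡ (x σ))) Lo-zero

    -- A cell outside `ρ` is refuted, but is provably below positive bounds only. Hence it also
    -- costs δ, and `volume` counts all cells.
    Hi-cell : ∀ σ b → ρ σ ≡ b → Hi γ (ind b * x σ + δ) (cell χ Ψ σ)
    Hi-cell σ true  e = subst (λ y → Hi γ (y + δ) (cell χ Ψ σ)) (sym (*-identityˡ (x σ)))
      (Hi-mono (cell-⊤ σ) (Approx.high (a σ)))
    Hi-cell σ false e = Hi-refuted (cell-out σ e)
      (<-≤-trans δ>0 (subst (_≤ ind false * x σ + δ) (+-identityˡ δ) (+-monoˡ-≤ δ (ind*-nonneg false σ))))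

    Lo-total : Lo γ (total ρ x) χ
    Lo-total = Lo-Σ□ χ Ψ (λ σ → ind*-nonneg (ρ σ) σ) (λ σ → Lo-cell σ (ρ σ) refl)

    Hi-total : Hi γ (total ρ x + volume k * δ) χ
    Hi-total = subst (λ y → Hi γ y χ)
      (trans (Σ□-+ k (λ σ → ind (ρ σ) * x σ) (λ _ → δ)) (cong (total ρ x +_) (Σ□-const k δ)))
      (Hi-Σ□ χ Ψ (λ σ → 0≤+ (ind*-nonneg (ρ σ) σ) (<⇒≤ δ>0)) (λ σ → Hi-cell σ (ρ σ) refl))

    total-nonneg : 0ℚ ≤ total ρ x
    total-nonneg = Σ□-nonneg (λ σ → ind*-nonneg (ρ σ) σ)

    -- The inequality between rationals is decidable; if it fails, the provable upper bound of
    -- `Hi-total` is below r and contradicts `L r χ`.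
    atLeast-or-refuted : ∀ η r → γ ⊢ L r χ → RowHolds η δ x (atLeast ρ (val r)) ⊎ Refuted γ
    atLeast-or-refuted η r p with val r ≤? total ρ x + volume k * δ
    ... | yes h = inj₁ (atLeast⁺ ρ η δ x (val r) h)
    ... | no ¬h = inj₂ (refute p (Hi-total r (<⇒≤ (≰⇒> ¬h))))

    atMost-or-refuted : ∀ η s → 0ℚ ≤ η → Hi γ (val s - η) χ → RowHolds η δ x (atMost ρ (val s) 1ℚ) ⊎ Refuted γ
    atMost-or-refuted η s η≥0 hi with total ρ x ≤? val s - η
    ... | yes h = inj₁ (atMost⁺ ρ η δ x (val s) 1ℚ (subst (λ y → total ρ x ≤ val s - y) (sym (*-identityˡ η)) h))
    ... | no ¬h = inj₂ (Lo-Hi-refute total-nonneg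
          (≤-trans (≤-from-gap η≥0 (solve 2 (λ s η → s :- (s :- η) := η) refl (val s) η)) (val≤1 s))
          (<⇒≤ (≰⇒> ¬h)) Lo-total hi)

-- Realising or refuting a set of L-literals

all-or : ∀ {A : Set} {P : A → Set} {B : Set} {xs} → All (λ x → P x ⊎ B) xs → All P xs ⊎ B
all-or []              = inj₁ []
all-or (inj₂ b ∷ _)    = inj₂ b
all-or (inj₁ p ∷ ps) with all-or ps
... | inj₁ qs = inj₁ (p ∷ qs)
... | inj₂ b  = inj₂ b

-- Two formulas, because case distinctions refute extensions π of the original φ, while a tree only
-- has to satisfy φ.
Outcome : Form → Form → Set
Outcome φ π = Refuted π ⊎ ∃[ t ] sat φ t ≡ true

Verdict : Form → Set
Verdict φ = Outcome φ φ

Matches-sat : ∀ {k} (Ψ : Vec Form k) σ t → sat (cell ⊤' Ψ σ) t ≡ true → ∀ i → sat (lookup Ψ i) t ≡ lookup σ i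
Matches-sat Ψ σ t h i = trans (sym (eval-sat (lookup Ψ i) t))
  (proj₂ (True-cell⁻ (λ ψ → sat ψ t) ⊤' Ψ σ (trans (eval-sat (cell ⊤' Ψ σ) t) h)) i)

module _ {k} (τ : Vec Bool k) (R : Vec Q01 k) (Ψ : Vec Form k)
         (verdict : ∀ σ → Verdict (cell ⊤' Ψ σ)) where

  satisfiable : Vec Bool k → Bool
  satisfiable σ = [ const false , const true ]′ (verdict σ)

  unsatisfiable⇒refuted : ∀ σ → satisfiable σ ≡ false → Refuted (cell ⊤' Ψ σ)
  unsatisfiable⇒refuted σ e with verdict σ
  ... | inj₁ p = p
  unsatisfiable⇒refuted σ () | inj₂ _

  -- The default `leaf` on refuted cells is harmless, since these get weight 0.
  witness : Vec Bool k → Tree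
  witness σ = [ const leaf , proj₁ ]′ (verdict σ)

  everything : Vec Bool k → Bool
  everything _ = true

  literalRow : Bool → Q01 → Fin k → Row k affine
  literalRow true  r i = atLeast (λ σ → lookup σ i) (val r)
  literalRow false r i = atMost  (λ σ → lookup σ i) (val r) 1ℚ

  rows : List (Row k affine)
  rows = atMost everything 1ℚ 0ℚ ∷ atLeast everything 1ℚ ∷
         List.tabulate (λ i → literalRow (lookup τ i) (lookup R i) i)

  total-everything : ∀ x → total everything x ≡ Σ□ x
  total-everything x = Σ□-cong (λ σ → *-identityˡ (x σ))

  witness-mass : ∀ {x} i → Supported satisfiable x → ∀ σ →
    (if sat (lookup Ψ i) (witness σ) then x σ else 0ℚ) ≡ ind (lookup σ i) * x σ
  witness-mass {x} i supp σ with verdict σ | proj₂ (supp σ)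
  ... | inj₁ _ | x≡0 rewrite x≡0 refl =
        trans (if-same (sat (lookup Ψ i) leaf)) (sym (*-zeroʳ (ind (lookup σ i))))
    where
    if-same : ∀ b → (if b then 0ℚ else 0ℚ) ≡ 0ℚ
    if-same true  = refl
    if-same false = refl
  ... | inj₂ (t , h) | _ rewrite Matches-sat Ψ σ t h i = if-ind (lookup σ i)
    where
    if-ind : ∀ b → (if b then x σ else 0ℚ) ≡ ind b * x σ
    if-ind true  = sym (*-identityˡ (x σ))
    if-ind false = sym (*-zeroˡ (x σ))

  -- The label and the successor are arbitrary, which leaves them free for the variables and the
  -- ○-literals.
  RealisedBy : (w : Vec Bool k → ℚ) → (∀ σ → 0ℚ ≤ w σ) → Σ□ w ≡ 1ℚ → Set
  RealisedBy w w≥0 Σw≡1 = ∀ ℓ u i →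
    sat (L (lookup R i) (lookup Ψ i)) (node ℓ u k w w≥0 Σw≡1 witness) ≡ lookup τ i

  -- At δ = 0 the slack disappears, so the weights sum to exactly 1; η > 0 makes the inequalities
  -- for negated literals strict.
  realise : ∀ {η x} → 0ℚ < η → Feasible affine satisfiable rows (η , 0ℚ , tt) x →
            ∃[ w≥0 ] ∃[ Σw≡1 ] RealisedBy x w≥0 Σw≡1
  realise {η} {x} η>0 (supp , h₁ ∷ h₂ ∷ hs) = (proj₁ ∘ supp) , Σ≡1 , realised
    where
    K*0 : ∀ y → y + volume k * 0ℚ ≡ y
    K*0 y = trans (cong (y +_) (*-zeroʳ (volume k))) (+-identityʳ y)
    Σ≡1 : Σ□ x ≡ 1ℚ
    Σ≡1 = ≤-antisym
      (subst₂ _≤_ (total-everything x) (solve 1 (λ η → con 1ℚ :- con 0ℚ :* η := con 1ℚ) refl η)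
        (atMost⁻ everything η 0ℚ x 1ℚ 0ℚ h₁))
      (subst (1ℚ ≤_) (trans (K*0 _) (total-everything x)) (atLeast⁻ everything η 0ℚ x 1ℚ h₂))
    realised : RealisedBy x (proj₁ ∘ supp) Σ≡1
    realised ℓ u i = go (lookup τ i) (All.tabulate⁻ hs i)
      where
      t : Tree
      t = node ℓ u k x (proj₁ ∘ supp) Σ≡1 witness
      r : Q01
      r = lookup R i
      ψ : Form
      ψ = lookup Ψ i
      prob≡ : prob (sat ψ) t ≡ total (λ σ → lookup σ i) x
      prob≡ = Σ□-cong (witness-mass i supp)
      go : ∀ b → RowHolds η 0ℚ x (literalRow b r i) → sat (L r ψ) t ≡ b
      go true  h = true-L r ψ t (subst (val r ≤_) (trans (K*0 _) (sym prob≡))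
        (atLeast⁻ (λ σ → lookup σ i) η 0ℚ x (val r) h))
      go false h = false-L r ψ t (≤-<-trans (subst (_≤ val r - 1ℚ * η) (sym prob≡)
          (atMost⁻ (λ σ → lookup σ i) η 0ℚ x (val r) 1ℚ h))
        (<-from-gap η>0 (solve 2 (λ s η → s :- (s :- con 1ℚ :* η) := η) refl (val r) η)))

  -- `strengthen` yields a margin t, infeasibility then an η ≤ t with a δ, and `approximate-cells`
  -- values x accurate to δ. Each row either holds at x or its failure refutes the context; they
  -- cannot all hold.
  refute-infeasible :
    ArbitrarilySmall (λ η δ → ∀ x → ¬ Feasible affine satisfiable rows (η , δ , tt) x) →
    ∀ γ → (∀ i → γ ⊢ literal τ R Ψ i) → Refuted γ
  refute-infeasible infeasible γ lits = strengthen τ R Ψ γ lits λ γ₁ t p t>0 his →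
    let η , δ , η>0 , η≤t , δ>0 , ¬feas = infeasible t t>0 in
    approximate-cells δ>0 k satisfiable (cell ⊤' Ψ) unsatisfiable⇒refuted γ₁ λ γ₂ x q a →
      [ (λ h → contradiction ((λ σ → Approx.≥0 (a σ) , Approx.null (a σ)) , h) (¬feas x)) , id ]′
        (all-or (row-total γ₂ x η δ a
          ∷ atLeast-or-refuted Ψ {⊤'} {everything} det-⊤ δ>0 a η one01 (⊢-thm (nec-L (taut True-⊤)))
          ∷ All.tabulate⁺ (λ i → row-literal γ₂ x η δ a η>0 δ>0 i (lookup τ i) (⊢-trans (⊢-trans q p) (lits i))
              (λ e → Hi-weaken q (λ r h → his i e r
                (≤-trans (+-monoʳ-≤ (val (lookup R i)) (neg-antimono-≤ η≤t)) h))))))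
    where
    det-⊤ : Determines Ψ ⊤' everything
    det-⊤ v σ m = True-⊤ v
    row-total : ∀ γ x η δ → (∀ σ → Approx (satisfiable σ) δ γ (cell ⊤' Ψ σ) (x σ)) →
                RowHolds η δ x (atMost everything 1ℚ 0ℚ) ⊎ Refuted γ
    row-total γ x η δ a with Σ□ x ≤? 1ℚ
    ... | yes h = inj₁ (atMost⁺ everything η δ x 1ℚ 0ℚ
          (subst₂ _≤_ (sym (total-everything x)) (solve 1 (λ η → con 1ℚ := con 1ℚ :- con 0ℚ :* η) refl η) h))
    ... | no ¬h = inj₂ (Σ□-over ⊤' Ψ (Approx.≥0 ∘ a) (Approx.≤1 ∘ a) (Approx.low ∘ a) (≰⇒> ¬h))
    row-literal : ∀ γ x η δ → (∀ σ → Approx (satisfiable σ) δ γ (cell ⊤' Ψ σ) (x σ)) → 0ℚ < η → 0ℚ < δ →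
                  ∀ i b → γ ⊢ sgn b (L (lookup R i) (lookup Ψ i)) →
                  (b ≡ false → Hi γ (val (lookup R i) - η) (lookup Ψ i)) →
                  RowHolds η δ x (literalRow b (lookup R i) i) ⊎ Refuted γ
    row-literal γ x η δ a η>0 δ>0 i true  p _ =
      atLeast-or-refuted Ψ {ρ = λ σ → lookup σ i} (λ v σ m → m i) δ>0 a η (lookup R i) p
    row-literal γ x η δ a η>0 δ>0 i false _ hi =
      atMost-or-refuted Ψ {ρ = λ σ → lookup σ i} (λ v σ m → m i) δ>0 a η (lookup R i) (<⇒≤ η>0) (hi refl)

  realise-or-refute : (∃[ w ] ∃[ w≥0 ] ∃[ Σw≡1 ] RealisedBy w w≥0 Σw≡1)
                    ⊎ (∀ γ → (∀ i → γ ⊢ literal τ R Ψ i) → Refuted γ)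
  realise-or-refute with feasible? satisfiable rows
  ... | inj₁ (η , η>0 , x , feas) = inj₁ (x , realise η>0 feas)
  ... | inj₂ infeasible = inj₂ (refute-infeasible infeasible)

-- Decision procedure

⊢○-∧ : ∀ {γ π} b θ → γ ⊢ ○ π → γ ⊢ sgn b (○ θ) → γ ⊢ ○ (π ∧' sgn b θ)
⊢○-∧ {γ} {π} b θ p q = ⊢-infer (⊢-thm (ax-○∧ π (sgn b θ)) ∷ p ∷ ⊢○-sgn b q ∷ [])
  λ { v _ (h₁ ∷ h₂ ∷ h₃ ∷ []) → ⇒-elim (∧-right h₁) (∧-intro h₂ h₃) }
  where
  ∧-right : ∀ {a b} → a ∧ b ≡ true → b ≡ true
  ∧-right {true} h = h
  ⊢○-sgn : ∀ b → γ ⊢ sgn b (○ θ) → γ ⊢ ○ (sgn b θ)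
  ⊢○-sgn true  q = q
  ⊢○-sgn false q = ⊢-infer (⊢-thm (ax-○¬ θ) ∷ q ∷ [])
    λ { v _ (h₁ ∷ h₂ ∷ []) → ⇒-elim (∧-right h₁) h₂ }

⊢○-cell : ∀ {k γ} π (Θ : Vec Form k) σ → γ ⊢ ○ π →
          (∀ i → γ ⊢ sgn (lookup σ i) (○ (lookup Θ i))) → γ ⊢ ○ (cell π Θ σ)
⊢○-cell π []      []      p h = p
⊢○-cell π (θ ∷ Θ) (b ∷ σ) p h = ⊢○-cell (π ∧' sgn b θ) Θ σ (⊢○-∧ b θ p (h zero)) (h ∘ suc)

refute-○ : ∀ {γ φ} → γ ⊢ ○ φ → Refuted φ → Refuted γ
refute-○ {γ} {φ} p q = refute p (⊢-infer (⊢-thm (ax-○¬ φ) ∷ ⊢-thm (nec-○ q) ∷ [])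
  λ { v _ (h₁ ∷ h₂ ∷ []) → ⇒-elim (∧-left h₁) h₂ })
  where
  ∧-left : ∀ {a b} → a ∧ b ≡ true → a ≡ true
  ∧-left {true} h = refl

-- Atoms of a formula and their valuations

valuation : ∀ {k} → Vec ℕ k → Vec Bool k → ℕ → Bool
valuation []       []      n = false
valuation (i ∷ is) (b ∷ σ) n with n ℕ.≟ i
... | yes _ = b
... | no  _ = valuation is σ n

-- A variable may be listed repeatedly, and `valuation` takes its first sign. If some u matches all
-- signs, repeated entries agree; so if `valuation` fails to match, the signs are contradictory.
valuation-unique : ∀ {k} (is : Vec ℕ k) σ (u : ℕ → Bool) → (∀ j → u (lookup is j) ≡ lookup σ j) →
                   ∀ j → valuation is σ (lookup is j) ≡ lookup σ j
valuation-unique is σ u h j = trans (agrees is σ h j) (h j)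
  where
  agrees : ∀ {k} (is : Vec ℕ k) σ → (∀ j → u (lookup is j) ≡ lookup σ j) →
           ∀ j → valuation is σ (lookup is j) ≡ u (lookup is j)
  agrees (i ∷ is) (b ∷ σ) h j with lookup (i ∷ is) j ℕ.≟ i
  ... | yes e = trans (sym (h zero)) (cong u (sym e))
  agrees (i ∷ is) (b ∷ σ) h zero    | no ≢i = contradiction refl ≢i
  agrees (i ∷ is) (b ∷ σ) h (suc j) | no _  = agrees is σ (h ∘ suc) j

vars : Form → List ℕ
vars (var i)  = i ∷ []
vars (¬' φ)   = vars φ
vars (φ ∧' ψ) = vars φ ++ vars ψ
vars (L r φ)  = []
vars (○ φ)    = []

boxes : Form → List (Q01 × Form)
boxes (var i)  = []
boxes (¬' φ)   = boxes φ
boxes (φ ∧' ψ) = boxes φ ++ boxes ψ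
boxes (L r φ)  = (r , φ) ∷ []
boxes (○ φ)    = []

nexts : Form → List Form
nexts (var i)  = []
nexts (¬' φ)   = nexts φ
nexts (φ ∧' ψ) = nexts φ ++ nexts ψ
nexts (L r φ)  = []
nexts (○ φ)    = φ ∷ []

depth : Form → ℕ
depth (var i)  = 0
depth (¬' φ)   = depth φ
depth (φ ∧' ψ) = depth φ ℕ.⊔ depth ψ
depth (L r φ)  = suc (depth φ)
depth (○ φ)    = suc (depth φ)

boxes-depth : ∀ {n} φ → depth φ ℕ.≤ n → All (λ (_ , ψ) → depth ψ ℕ.< n) (boxes φ)
boxes-depth (var i)  d = []
boxes-depth (¬' φ)   d = boxes-depth φ d
boxes-depth (φ ∧' ψ) d = All.++⁺ (boxes-depth φ (ℕ.m⊔n≤o⇒m≤o _ _ d)) (boxes-depth ψ (ℕ.m⊔n≤o⇒n≤o _ _ d))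
boxes-depth (L r φ)  d = d ∷ []
boxes-depth (○ φ)    d = []

nexts-depth : ∀ {n} φ → depth φ ℕ.≤ n → All (λ ψ → depth ψ ℕ.< n) (nexts φ)
nexts-depth (var i)  d = []
nexts-depth (¬' φ)   d = nexts-depth φ d
nexts-depth (φ ∧' ψ) d = All.++⁺ (nexts-depth φ (ℕ.m⊔n≤o⇒m≤o _ _ d)) (nexts-depth ψ (ℕ.m⊔n≤o⇒n≤o _ _ d))
nexts-depth (L r φ)  d = []
nexts-depth (○ φ)    d = d ∷ []

cell-depth : ∀ {k n} π (Ψ : Vec Form k) σ → depth π ℕ.≤ n →
             (∀ i → depth (lookup Ψ i) ℕ.≤ n) → depth (cell π Ψ σ) ℕ.≤ n
cell-depth π []      []      d h = d
cell-depth {n = n} π (ψ ∷ Ψ) (b ∷ σ) d h = cell-depth (π ∧' sgn b ψ) Ψ σ (ℕ.⊔-lub d (sgn-depth b)) (h ∘ suc)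
  where
  sgn-depth : ∀ b → depth (sgn b ψ) ℕ.≤ n
  sgn-depth true  = h zero
  sgn-depth false = h zero

eval-cong : ∀ v w φ → All (λ i → v (var i) ≡ w (var i)) (vars φ) →
            All (λ (r , ψ) → v (L r ψ) ≡ w (L r ψ)) (boxes φ) →
            All (λ ψ → v (○ ψ) ≡ w (○ ψ)) (nexts φ) → eval v φ ≡ eval w φ
eval-cong v w (var i)  (h ∷ []) _ _ = h
eval-cong v w (¬' φ)   a b c = cong not (eval-cong v w φ a b c)
eval-cong v w (φ ∧' ψ) a b c = cong₂ _∧_
  (eval-cong v w φ (All.++⁻ˡ (vars φ) a) (All.++⁻ˡ (boxes φ) b) (All.++⁻ˡ (nexts φ) c))
  (eval-cong v w ψ (All.++⁻ʳ (vars φ) a) (All.++⁻ʳ (boxes φ) b) (All.++⁻ʳ (nexts φ) c))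
eval-cong v w (L r φ)  _ (h ∷ []) _ = h
eval-cong v w (○ φ)    _ _ (h ∷ []) = h

module _ {A : Set} {P : A → Set} where

  All-fromList⁻ : ∀ {xs} → All P xs → ∀ i → P (lookup (fromList xs) i)
  All-fromList⁻ (p ∷ ps) zero    = p
  All-fromList⁻ (p ∷ ps) (suc i) = All-fromList⁻ ps i

  All-fromList⁺ : ∀ xs → (∀ i → P (lookup (fromList xs) i)) → All P xs
  All-fromList⁺ []       h = []
  All-fromList⁺ (x ∷ xs) h = h zero ∷ All-fromList⁺ xs (h ∘ suc)

outcome-by-cells : ∀ {k} φ π (Ψ : Vec Form k) → (∀ σ → Outcome φ (cell π Ψ σ)) → Outcome φ π
outcome-by-cells φ π []      h = h []
outcome-by-cells φ π (ψ ∷ Ψ) h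
  with outcome-by-cells φ (π ∧' ψ) Ψ (h ∘ (true ∷_)) | outcome-by-cells φ (π ∧' ¬' ψ) Ψ (h ∘ (false ∷_))
... | inj₂ t | _      = inj₂ t
... | inj₁ _ | inj₂ t = inj₂ t
... | inj₁ p | inj₁ q = inj₁ (by-cases ψ p q)

-- Mutual recursion with `decide-cell` on the depth bound n: arguments of L and ○ in φ have depth
-- below n, and so do the cells formed from them.
decide : ∀ n φ → depth φ ℕ.≤ n → Verdict φ
decide-cell : ∀ n {k} (Ψ : Vec Form k) σ → (∀ i → depth (lookup Ψ i) ℕ.< n) → Verdict (cell ⊤' Ψ σ)

decide n φ d =
  outcome-by-cells φ φ V λ σ₁ →
  outcome-by-cells φ (cell φ V σ₁) B λ σ₂ →
  outcome-by-cells φ (cell (cell φ V σ₁) B σ₂) N λ σ₃ →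
  settle σ₁ σ₂ σ₃
  where
  is = fromList (vars φ)
  bs = fromList (boxes φ)
  R = Vec.map proj₁ bs
  Ψ = Vec.map proj₂ bs
  Θ = fromList (nexts φ)
  V = Vec.map var is
  B = Vec.map (λ (r , ψ) → L r ψ) bs
  N = Vec.map ○ Θ

  module _ (σ₁ : Vec Bool (List.length (vars φ))) (σ₂ : Vec Bool (List.length (boxes φ)))
           (σ₃ : Vec Bool (List.length (nexts φ))) where
    γ : Form
    γ = cell (cell (cell φ V σ₁) B σ₂) N σ₃

    True-γ : ∀ v → True v γ → True v φ × (∀ i → v (var (lookup is i)) ≡ lookup σ₁ i) ×
             (∀ i → v (L (proj₁ (lookup bs i)) (proj₂ (lookup bs i))) ≡ lookup σ₂ i) ×
             (∀ i → v (○ (lookup Θ i)) ≡ lookup σ₃ i)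
    True-γ v h =
      let h₂ , m₃ = True-cell⁻ v (cell (cell φ V σ₁) B σ₂) N σ₃ h
          h₁ , m₂ = True-cell⁻ v (cell φ V σ₁) B σ₂ h₂
          h₀ , m₁ = True-cell⁻ v φ V σ₁ h₁
      in h₀ , (λ i → trans (cong (eval v) (sym (lookup-map i var is))) (m₁ i)) ,
              (λ i → trans (cong (eval v) (sym (lookup-map i (λ (r , ψ) → L r ψ) bs))) (m₂ i)) ,
              (λ i → trans (cong (eval v) (sym (lookup-map i ○ Θ))) (m₃ i))

    γ⊢box : ∀ i → γ ⊢ literal σ₂ R Ψ i
    γ⊢box i = ⊢-infer [] λ v h _ → sgn-eval v (lookup σ₂ i) _
      (trans (cong₂ (λ r ψ → v (L r ψ)) (lookup-map i proj₁ bs) (lookup-map i proj₂ bs))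
        (proj₁ (proj₂ (proj₂ (True-γ v h))) i))

    γ⊢next : ∀ i → γ ⊢ sgn (lookup σ₃ i) (○ (lookup Θ i))
    γ⊢next i = ⊢-infer [] λ v h _ → sgn-eval v (lookup σ₃ i) (○ (lookup Θ i))
      (proj₂ (proj₂ (proj₂ (True-γ v h))) i)

    Ψ-depth : ∀ i → depth (lookup Ψ i) ℕ.< n
    Ψ-depth i = subst (λ ψ → depth ψ ℕ.< n) (sym (lookup-map i proj₂ bs)) (All-fromList⁻ (boxes-depth φ d) i)

    settle : Outcome φ γ
    settle with Fin.all? (λ i → valuation is σ₁ (lookup is i) ≟ᵇ lookup σ₁ i)
    ... | no inconsistent = inj₁ (taut λ v → cong not (¬-not λ h →
          inconsistent (valuation-unique is σ₁ (v ∘ var) (proj₁ (proj₂ (True-γ v h))))))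
    ... | yes consistent with decide-cell n Θ σ₃ (All-fromList⁻ (nexts-depth φ d))
    ... | inj₁ p = inj₁ (refute-○ (⊢○-cell ⊤' Θ σ₃ (⊢-thm (nec-○ (taut True-⊤))) γ⊢next) p)
    ... | inj₂ (u , hu) with realise-or-refute σ₂ R Ψ (λ σ → decide-cell n Ψ σ Ψ-depth)
    ... | inj₂ ref = inj₁ (ref γ γ⊢box)
    -- At `t` the atoms of φ have the truth values prescribed by `γ`, yet φ may come out false
    -- there. Then `γ`, which has φ as a conjunct, is a propositional contradiction.
    ... | inj₁ (w , w≥0 , Σw≡1 , realised) = conclude (sat φ t) refl
      where
      t : Tree
      t = node (valuation is σ₁) u _ w w≥0 Σw≡1 (witness σ₂ R Ψ (λ σ → decide-cell n Ψ σ Ψ-depth))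
      agree : ∀ v → True v γ → eval v φ ≡ sat φ t
      agree v h = let _ , m₁ , m₂ , m₃ = True-γ v h in
        trans (eval-cong v (λ ψ → sat ψ t) φ
          (All-fromList⁺ (vars φ) λ i → trans (m₁ i) (sym (consistent i)))
          (All-fromList⁺ (boxes φ) λ i → trans (m₂ i) (sym (trans
            (cong₂ (λ r ψ → sat (L r ψ) t) (sym (lookup-map i proj₁ bs)) (sym (lookup-map i proj₂ bs)))
            (realised (valuation is σ₁) u i))))
          (All-fromList⁺ (nexts φ) λ i → trans (m₃ i) (sym (Matches-sat Θ σ₃ u hu i))))
          (eval-sat φ t)
      conclude : ∀ b → sat φ t ≡ b → Outcome φ γ
      conclude true  e = inj₂ (t , e)
      conclude false e = inj₁ (taut λ v → cong not (¬-not λ h →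
        true≢false (proj₁ (True-γ v h)) (trans (agree v h) e)))

-- No formula has depth below 0, so only the empty cell `⊤'` remains, and it holds at every tree.
decide-cell zero    []      []      h = inj₂ (leaf , refl)
decide-cell zero    (ψ ∷ Ψ) (b ∷ σ) h with h zero
... | ()
decide-cell (suc n) Ψ       σ       h = decide n (cell ⊤' Ψ σ)
  (cell-depth ⊤' Ψ σ ℕ.z≤n (λ i → ℕ.≤-pred (h i)))

theorem2p18 : (φ : Form) → Dec (Thm φ)
-- A refutation of ¬φ is a derivation of ¬¬φ; a tree satisfying ¬φ excludes a derivation of φ by
-- soundness.
theorem2p18 φ with decide (depth (¬' φ)) (¬' φ) ℕ.≤-refl
... | inj₁ ¬¬φ = yes (infer (¬¬φ ∷ []) λ { v (h ∷ []) → double-negation h })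
  where
  double-negation : ∀ {b} → not (not b) ≡ true → b ≡ true
  double-negation {true} _ = refl
... | inj₂ (t , h) = no λ p → true≢false (sound p t) (not-true h)
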